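{- Let $q$ be a power of a prime $p$, $n\ge1$, $1\le r\le n$, $V=\mathbb{F}_q^{n+1}$, $\mathcal{L}_1$ the set of $1$-dimensional subspaces and $\mathcal{L}_r$ the set of $r$-dimensional subspaces of $V$, and let $A$ be the integer $|\mathcal{L}_r|\times|\mathcal{L}_1|$ $(0,1)$-matrix with $(Y,Z)$-entry $1$ iff $Z\subseteq Y$ (the matrix over $\mathbb{Z}$ of the map $\mathbb{Z}^{\mathcal{L}_1}\to\mathbb{Z}^{\mathcal{L}_r}$ sending each $Z\in\mathcal{L}_1$ to the formal sum of the $Y\in\mathcal{L}_r$ containing it). Let $v=|\mathcal{L}_1|$. Then the invariant factors of $A$ over $\mathbb{Z}$ are all powers of $p$, except the $v$-th invariant factor, which is a power of $p$ times $(q^r-1)/(q-1)$. -}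

module Defs where

open import Level using (0ℓ)
open import Data.Nat as ℕ using (ℕ; zero; suc; _^_; _∸_; _/_)
open import Data.Nat.Divisibility using (_∣_)
open import Data.Fin using (Fin; toℕ; zero; suc)
open import Data.Integer as ℤ using (ℤ; +_)
open import Data.Product using (Σ; ∃; _×_; _,_)
open import Data.Sum using (_⊎_)
open import Relation.Binary.PropositionalEquality using (_≡_; _≢_)
open import Relation.Nullary using (¬_; yes; no)
open import Algebra.Core using (Op₁; Op₂)
open import Algebra.Structures using (IsCommutativeRing)
open import Function.Bundles using (_↔_)

record FiniteField (q : ℕ) : Set₁ where
  field
    F           : Set
    _+_ _*_     : Op₂ F
    -_          : Op₁ F
    0# 1#       : F
    isCommRing  : IsCommutativeRing _≡_ _+_ _*_ -_ 0# 1#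
    0≢1         : 0# ≢ 1#
    inverse     : ∀ x → x ≢ 0# → Σ F (λ y → (x * y) ≡ 1#)
    card        : F ↔ Fin q

module _ {q : ℕ} (𝔽 : FiniteField q) where
  open FiniteField 𝔽

  V : ℕ → Set
  V n = Fin (suc n) → F

  sumF : ∀ r → (Fin r → F) → F
  sumF zero    f = 0#
  sumF (suc r) f = f zero + sumF r (λ i → f (suc i))

  lincomb : ∀ {n r} → (Fin r → F) → (Fin r → V n) → V n
  lincomb {r = r} c b k = sumF r (λ i → c i * b i k)

  InSpan : ∀ {n r} → (Fin r → V n) → V n → Set
  InSpan {r = r} b x = Σ (Fin r → F) (λ c → ∀ k → x k ≡ lincomb c b k)

  LinIndep : ∀ {n r} → (Fin r → V n) → Set
  LinIndep {r = r} b =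
    (c : Fin r → F) → (∀ k → lincomb c b k ≡ 0#) → ∀ i → c i ≡ 0#

  Subset : ℕ → Set₁
  Subset n = V n → Set

  _⊆_ : ∀ {n} → Subset n → Subset n → Set
  W ⊆ W′ = ∀ x → W x → W′ x

  SameSub : ∀ {n} → Subset n → Subset n → Set
  SameSub W W′ = (W ⊆ W′) × (W′ ⊆ W)

  IsSubspaceOfDim : ∀ {n} → ℕ → Subset n → Set
  IsSubspaceOfDim {n} r W =
    Σ (Fin r → V n) (λ b → LinIndep b × (∀ x → (W x → InSpan b x) × (InSpan b x → W x)))

  record Enumerates (n r N : ℕ) (Y : Fin N → Subset n) : Set₁ where
    field
      isSub    : ∀ i → IsSubspaceOfDim r (Y i)
      distinct : ∀ i j → SameSub (Y i) (Y j) → i ≡ j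
      complete : ∀ W → IsSubspaceOfDim r W → ∃ λ i → SameSub W (Y i)

  IsIncidence : ∀ {n N v} → (Fin N → Subset n) → (Fin v → Subset n) →
                (Fin N → Fin v → ℤ) → Set
  IsIncidence Y Z A = ∀ i j →
    (A i j ≡ + 1 × Z j ⊆ Y i) ⊎ (A i j ≡ + 0 × ¬ (Z j ⊆ Y i))

Mat : ℕ → ℕ → Set
Mat m k = Fin m → Fin k → ℤ

sumℤ : ∀ r → (Fin r → ℤ) → ℤ
sumℤ zero    f = + 0
sumℤ (suc r) f = f zero ℤ.+ sumℤ r (λ i → f (suc i))

_⊗_ : ∀ {a b c} → Mat a b → Mat b c → Mat a c
_⊗_ {b = b} M M′ i j = sumℤ b (λ k → M i k ℤ.* M′ k j)

idM : ∀ {m} → Mat m m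
idM i j with toℕ i ℕ.≟ toℕ j
... | yes _ = + 1
... | no  _ = + 0

Invertible : ∀ {m} → Mat m m → Set
Invertible {m} P = Σ (Mat m m) (λ P′ → (∀ i j → (P ⊗ P′) i j ≡ idM i j) × (∀ i j → (P′ ⊗ P) i j ≡ idM i j))

Diag : ∀ {N v} → (Fin v → ℕ) → Mat N v
Diag d i j with toℕ i ℕ.≟ toℕ j
... | yes _ = + d j
... | no  _ = + 0

IsSmithForm : ∀ {N v} → Mat N v → (Fin v → ℕ) → Set
IsSmithForm {N} {v} A d =
  Σ (Mat N N) λ P → Σ (Mat v v) λ Q →
    Invertible P × Invertible Q × (∀ i j → ((P ⊗ A) ⊗ Q) i j ≡ Diag d i j)
    × (∀ (i j : Fin v) → suc (toℕ i) ≡ toℕ j → d i ∣ d j)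

-- the Gaussian number (q^r - 1)/(q - 1), for q ≥ 2 (value 0 otherwise, unused)
gauss : ℕ → ℕ → ℕ
gauss (suc (suc k)) r = (suc (suc k) ^ r ∸ 1) / suc k
gauss _             r = 0

{-# OPTIONS --safe #-}

-- Put s = q^(r-1), g = (q^r-1)/(q-1), and let L be the lattice spanned by the rows of A.
-- Every row sums to g, so L lies in K = {x : g ∣ Σ x}. Conversely let U be an
-- (r+1)-dimensional subspace and z a point of U. A point of U other than z lies on q^(r-1)
-- of the q^r hyperplanes of U that avoid z, so the sum of these hyperplanes is s (χ_U - z).
-- Taking the difference for two points of U gives s (z - z′) ∈ L, hence sK ⊆ L ⊆ K. Since
-- ℤ^v/K is cyclic of order g, the invariant factors other than the last divide s, and the
-- last one is g times a divisor of s.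
module Submission where

open import Defs
open import Algebra.Bundles using (CommutativeRing)
open import Algebra.Core using (Op₁; Op₂)
import Algebra.Properties.Ring as RingProperties
import Algebra.Solver.Ring.NaturalCoefficients.Default as SemiringSolver
open import Algebra.Structures using (IsCommutativeRing)
open import Data.Fin as Fin using (Fin; toℕ; zero; suc)
import Data.Fin.Properties as Fin
open import Data.Integer as ℤ using (ℤ; +_; ∣_∣)
import Data.Integer.DivMod as ℤ
open import Data.Integer.Divisibility.Signed as ℤ∣ using (divides) renaming (_∣_ to _∣ℤ_)
import Data.Integer.Properties as ℤ
open import Data.Integer.Tactic.RingSolver using (solve-∀)
open import Data.Nat as ℕ using (ℕ; zero; suc; _^_; _*_; _≤_)
open import Data.Nat.Coprimality using (Coprime; coprime-divisor)
open import Data.Nat.Divisibility as ℕ∣ using (_∣_)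
open import Data.Nat.DivMod using (m*n/n≡m)
open import Data.Nat.Induction using (<-wellFounded)
open import Data.Nat.Primality using (Prime; prime⇒nonZero; prime⇒nonTrivial; prime⇒irreducible)
import Data.Nat.Properties as ℕ
open import Data.Nat.Tactic.RingSolver using () renaming (solve-∀ to ℕ-solve-∀)
open import Data.Product using (Σ; ∃; ∃₂; _×_; _,_; proj₁; proj₂)
open import Data.Sum using (_⊎_; inj₁; inj₂)
open import Data.Vec.Functional using ([]; _∷_)
open import Function using (_∘_; flip; Inverse)
open import Induction.WellFounded using (Acc; acc)
open import Level using (0ℓ)
open import Relation.Binary.PropositionalEquality
open import Relation.Nullary using (¬_; Dec; yes; no; contradiction)
open import Relation.Nullary.Decidable using (decidable-stable; ¬?; map′)

-- The second half of the theorem concerns every Smith form `d` of `A`, so the factors are read off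
-- from an arbitrary pair of transforming matrices, with no appeal to uniqueness. The quotient of
-- ℤ^v by K never appears as a group: only the coordinate sum is carried to the new basis, where its
-- coefficients still generate the unit ideal.
--
-- Counting hyperplanes becomes linear algebra once a basis of U starts with a generator of z. The
-- hyperplanes avoiding z are the graphs a₀ = c₁a₁ + ... + c_r a_r, one for each c in F^r. For a
-- fixed point a this is one equation in the unknown c, with q^(r-1) solutions if some aᵢ with i ≥ 1
-- is nonzero, and none at z. Summed over all points, the same identity also yields the number g of
-- points of an r-dimensional subspace, by induction on the dimension.
--
-- For sK ⊆ L, the differences of points generate the vectors of sum zero, and one row is added to
-- reach the sum g. The bound r ≤ n is what makes room for U.

-- Finite sums, treated once for both `sumℤ` and `sumF`

module FiniteSum {R : Set} {_∔_ _·_ : Op₂ R} { -_ : Op₁ R} {0# 1# : R}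
  (isCR : IsCommutativeRing _≡_ _∔_ _·_ -_ 0# 1#)
  (S : ∀ n → (Fin n → R) → R)
  (S-zero : ∀ f → S 0 f ≡ 0#)
  (S-suc : ∀ n f → S (suc n) f ≡ (f zero ∔ S n (f ∘ suc))) where

  open IsCommutativeRing isCR using (+-assoc; +-comm; +-identityˡ; +-identityʳ; *-comm; zeroʳ; distribˡ)
  open ≡-Reasoning

  interchange : ∀ a b c d → ((a ∔ b) ∔ (c ∔ d)) ≡ ((a ∔ c) ∔ (b ∔ d))
  interchange a b c d = begin
    (a ∔ b) ∔ (c ∔ d)  ≡⟨ +-assoc a b (c ∔ d) ⟩
    a ∔ (b ∔ (c ∔ d))  ≡⟨ cong (a ∔_) (+-assoc b c d) ⟨
    a ∔ ((b ∔ c) ∔ d)  ≡⟨ cong (λ e → a ∔ (e ∔ d)) (+-comm b c) ⟩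
    a ∔ ((c ∔ b) ∔ d)  ≡⟨ cong (a ∔_) (+-assoc c b d) ⟩
    a ∔ (c ∔ (b ∔ d))  ≡⟨ +-assoc a c (b ∔ d) ⟨
    (a ∔ c) ∔ (b ∔ d)  ∎

  sum-cong : ∀ n {f g : Fin n → R} → f ≗ g → S n f ≡ S n g
  sum-cong zero    {f} {g} f≗g = trans (S-zero f) (sym (S-zero g))
  sum-cong (suc n) {f} {g} f≗g = begin
    S (suc n) f              ≡⟨ S-suc n f ⟩
    f zero ∔ S n (f ∘ suc)   ≡⟨ cong₂ _∔_ (f≗g zero) (sum-cong n (f≗g ∘ suc)) ⟩
    g zero ∔ S n (g ∘ suc)   ≡⟨ S-suc n g ⟨
    S (suc n) g              ∎

  sum-zero : ∀ n {f : Fin n → R} → (∀ i → f i ≡ 0#) → S n f ≡ 0#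
  sum-zero zero    {f} f≡0 = S-zero f
  sum-zero (suc n) {f} f≡0 = begin
    S (suc n) f              ≡⟨ S-suc n f ⟩
    f zero ∔ S n (f ∘ suc)   ≡⟨ cong₂ _∔_ (f≡0 zero) (sum-zero n (f≡0 ∘ suc)) ⟩
    0# ∔ 0#                  ≡⟨ +-identityˡ 0# ⟩
    0#                       ∎

  sum-+ : ∀ n (f g : Fin n → R) → S n (λ i → f i ∔ g i) ≡ (S n f ∔ S n g)
  sum-+ zero    f g = begin
    S 0 (λ i → f i ∔ g i)    ≡⟨ S-zero _ ⟩
    0#                       ≡⟨ +-identityˡ 0# ⟨
    0# ∔ 0#                  ≡⟨ cong₂ _∔_ (S-zero f) (S-zero g) ⟨
    S 0 f ∔ S 0 g            ∎
  sum-+ (suc n) f g = begin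
    S (suc n) (λ i → f i ∔ g i)                                 ≡⟨ S-suc n _ ⟩
    (f zero ∔ g zero) ∔ S n (λ i → f (suc i) ∔ g (suc i))
      ≡⟨ cong ((f zero ∔ g zero) ∔_) (sum-+ n (f ∘ suc) (g ∘ suc)) ⟩
    (f zero ∔ g zero) ∔ (S n (f ∘ suc) ∔ S n (g ∘ suc))         ≡⟨ interchange _ _ _ _ ⟩
    (f zero ∔ S n (f ∘ suc)) ∔ (g zero ∔ S n (g ∘ suc))
      ≡⟨ cong₂ _∔_ (S-suc n f) (S-suc n g) ⟨
    S (suc n) f ∔ S (suc n) g                                   ∎

  sum-*ˡ : ∀ n c (f : Fin n → R) → S n (λ i → c · f i) ≡ (c · S n f)
  sum-*ˡ zero    c f = begin
    S 0 (λ i → c · f i)      ≡⟨ S-zero _ ⟩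
    0#                       ≡⟨ zeroʳ c ⟨
    c · 0#                   ≡⟨ cong (c ·_) (S-zero f) ⟨
    c · S 0 f                ∎
  sum-*ˡ (suc n) c f = begin
    S (suc n) (λ i → c · f i)                   ≡⟨ S-suc n _ ⟩
    (c · f zero) ∔ S n (λ i → c · f (suc i))    ≡⟨ cong ((c · f zero) ∔_) (sum-*ˡ n c (f ∘ suc)) ⟩
    (c · f zero) ∔ (c · S n (f ∘ suc))          ≡⟨ distribˡ c _ _ ⟨
    c · (f zero ∔ S n (f ∘ suc))                ≡⟨ cong (c ·_) (S-suc n f) ⟨
    c · S (suc n) f                             ∎

  sum-*ʳ : ∀ n c (f : Fin n → R) → S n (λ i → f i · c) ≡ (S n f · c)
  sum-*ʳ n c f = trans (sum-cong n (λ i → *-comm (f i) c)) (trans (sum-*ˡ n c f) (*-comm c _))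

  sum-swap : ∀ m n (f : Fin m → Fin n → R) →
             S m (λ i → S n (f i)) ≡ S n (λ j → S m (λ i → f i j))
  sum-swap zero    n f = trans (S-zero _) (sym (sum-zero n (λ j → S-zero _)))
  sum-swap (suc m) n f = begin
    S (suc m) (λ i → S n (f i))                               ≡⟨ S-suc m _ ⟩
    S n (f zero) ∔ S m (λ i → S n (f (suc i)))
      ≡⟨ cong (S n (f zero) ∔_) (sum-swap m n (f ∘ suc)) ⟩
    S n (f zero) ∔ S n (λ j → S m (λ i → f (suc i) j))        ≡⟨ sum-+ n _ _ ⟨
    S n (λ j → f zero j ∔ S m (λ i → f (suc i) j))
      ≡⟨ sum-cong n (λ j → sym (S-suc m (λ i → f i j))) ⟩
    S n (λ j → S (suc m) (λ i → f i j))                       ∎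

  sum-single : ∀ n (k : Fin n) {f : Fin n → R} → (∀ i → i ≢ k → f i ≡ 0#) → S n f ≡ f k
  sum-single (suc n) zero    {f} f≡0 = begin
    S (suc n) f              ≡⟨ S-suc n f ⟩
    f zero ∔ S n (f ∘ suc)   ≡⟨ cong (f zero ∔_) (sum-zero n (λ i → f≡0 (suc i) λ ())) ⟩
    f zero ∔ 0#              ≡⟨ +-identityʳ _ ⟩
    f zero                   ∎
  sum-single (suc n) (suc k) {f} f≡0 = begin
    S (suc n) f              ≡⟨ S-suc n f ⟩
    f zero ∔ S n (f ∘ suc)
      ≡⟨ cong₂ _∔_ (f≡0 zero λ ()) (sum-single n k (λ i i≢k → f≡0 (suc i) (i≢k ∘ Fin.suc-injective))) ⟩
    0# ∔ f (suc k)           ≡⟨ +-identityˡ _ ⟩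
    f (suc k)                ∎

open FiniteSum ℤ.+-*-isCommutativeRing sumℤ (λ _ → refl) (λ _ _ → refl)
  hiding (interchange)

-- Matrices and equivalence

infix 4 _≐_
_≐_ : ∀ {a b} → Mat a b → Mat a b → Set
M ≐ M′ = ∀ i j → M i j ≡ M′ i j

idM-diag : ∀ {m} (i : Fin m) → idM i i ≡ + 1
idM-diag i with toℕ i ℕ.≟ toℕ i
... | yes _ = refl
... | no ¬p = contradiction refl ¬p

idM-off : ∀ {m} {i j : Fin m} → i ≢ j → idM i j ≡ + 0
idM-off {i = i} {j} i≢j with toℕ i ℕ.≟ toℕ j
... | yes p = contradiction (Fin.toℕ-injective p) i≢j
... | no  _ = refl

idM-sym : ∀ {m} (i j : Fin m) → idM i j ≡ idM j i
idM-sym i j with i Fin.≟ j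
... | yes refl = refl
... | no i≢j   = trans (idM-off i≢j) (sym (idM-off (i≢j ∘ sym)))

idM-suc : ∀ {m} (i j : Fin m) → idM (suc i) (suc j) ≡ idM i j
idM-suc i j with i Fin.≟ j
... | yes refl = trans (idM-diag (suc i)) (sym (idM-diag i))
... | no i≢j   = trans (idM-off (i≢j ∘ Fin.suc-injective)) (sym (idM-off i≢j))

sum-idMˡ : ∀ {m} (i : Fin m) (f : Fin m → ℤ) → sumℤ m (λ k → idM i k ℤ.* f k) ≡ f i
sum-idMˡ {m} i f = trans
  (sum-single m i (λ k k≢i → trans (cong (ℤ._* f k) (idM-off (k≢i ∘ sym))) (ℤ.*-zeroˡ (f k))))
  (trans (cong (ℤ._* f i) (idM-diag i)) (ℤ.*-identityˡ (f i)))

sum-idMʳ : ∀ {m} (j : Fin m) (f : Fin m → ℤ) → sumℤ m (λ k → f k ℤ.* idM k j) ≡ f j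
sum-idMʳ {m} j f = trans
  (sum-cong m (λ k → trans (ℤ.*-comm (f k) _) (cong (ℤ._* f k) (idM-sym k j))))
  (sum-idMˡ j f)

⊗-cong : ∀ {a b c} {M M′ : Mat a b} {K K′ : Mat b c} → M ≐ M′ → K ≐ K′ → M ⊗ K ≐ M′ ⊗ K′
⊗-cong {b = b} M≐ K≐ i j = sum-cong b (λ k → cong₂ ℤ._*_ (M≐ i k) (K≐ k j))

⊗-identityˡ : ∀ {a b} (M : Mat a b) → idM ⊗ M ≐ M
⊗-identityˡ M i j = sum-idMˡ i (λ k → M k j)

⊗-identityʳ : ∀ {a b} (M : Mat a b) → M ⊗ idM ≐ M
⊗-identityʳ M i j = sum-idMʳ j (M i)

⊗-assoc : ∀ {a b c d} (M : Mat a b) (K : Mat b c) (L : Mat c d) → (M ⊗ K) ⊗ L ≐ M ⊗ (K ⊗ L)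
⊗-assoc {b = b} {c} M K L i j = begin
  sumℤ c (λ k → sumℤ b (λ l → M i l ℤ.* K l k) ℤ.* L k j)
    ≡⟨ sum-cong c (λ k → sym (sum-*ʳ b (L k j) _)) ⟩
  sumℤ c (λ k → sumℤ b (λ l → M i l ℤ.* K l k ℤ.* L k j))
    ≡⟨ sum-swap c b _ ⟩
  sumℤ b (λ l → sumℤ c (λ k → M i l ℤ.* K l k ℤ.* L k j))
    ≡⟨ sum-cong b (λ l → trans (sum-cong c (λ k → ℤ.*-assoc (M i l) (K l k) (L k j))) (sum-*ˡ c (M i l) _)) ⟩
  sumℤ b (λ l → M i l ℤ.* sumℤ c (λ k → K l k ℤ.* L k j)) ∎
  where open ≡-Reasoning

≐-sym : ∀ {a b} {M M′ : Mat a b} → M ≐ M′ → M′ ≐ M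
≐-sym e i j = sym (e i j)

≐-trans : ∀ {a b} {M M′ M″ : Mat a b} → M ≐ M′ → M′ ≐ M″ → M ≐ M″
≐-trans e e′ i j = trans (e i j) (e′ i j)

⊗-congˡ : ∀ {a b c} (M : Mat a b) {K K′ : Mat b c} → K ≐ K′ → M ⊗ K ≐ M ⊗ K′
⊗-congˡ M = ⊗-cong {M = M} (λ _ _ → refl)

⊗-congʳ : ∀ {a b c} {M M′ : Mat a b} (K : Mat b c) → M ≐ M′ → M ⊗ K ≐ M′ ⊗ K
⊗-congʳ K M≐ = ⊗-cong {K = K} M≐ (λ _ _ → refl)

⊗-transpose : ∀ {a b c} (M : Mat a b) (K : Mat b c) → flip (M ⊗ K) ≐ flip K ⊗ flip M
⊗-transpose {b = b} M K i j = sum-cong b (λ k → ℤ.*-comm (M j k) (K k i))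

⊗-cancel-inner : ∀ {a b c} {P P′ : Mat b b} (M : Mat a b) (K : Mat b c) →
                 P ⊗ P′ ≐ idM → (M ⊗ P) ⊗ (P′ ⊗ K) ≐ M ⊗ K
⊗-cancel-inner {P = P} {P′} M K PP′ =
  ≐-trans (⊗-assoc M P (P′ ⊗ K)) (⊗-congˡ M
    (≐-trans (≐-sym (⊗-assoc P P′ K)) (≐-trans (⊗-congʳ K PP′) (⊗-identityˡ K))))

Invertible-id : ∀ {m} → Invertible (idM {m})
Invertible-id = idM , ⊗-identityˡ idM , ⊗-identityˡ idM

Invertible-⊗ : ∀ {m} {P Q : Mat m m} → Invertible P → Invertible Q → Invertible (P ⊗ Q)
Invertible-⊗ {P = P} {Q} (P′ , PP′ , P′P) (Q′ , QQ′ , Q′Q) =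
  Q′ ⊗ P′ , ≐-trans (⊗-cancel-inner P P′ QQ′) PP′ , ≐-trans (⊗-cancel-inner Q′ Q P′P) Q′Q

Invertible-transpose : ∀ {m} {P : Mat m m} → Invertible P → Invertible (flip P)
Invertible-transpose {P = P} (P′ , PP′ , P′P) = flip P′ ,
  ≐-trans (≐-sym (⊗-transpose P′ P)) (λ i j → trans (P′P j i) (idM-sym j i)) ,
  ≐-trans (≐-sym (⊗-transpose P P′)) (λ i j → trans (PP′ j i) (idM-sym j i))

infix 4 _∼_
record _∼_ {a b} (A B : Mat a b) : Set where
  constructor equivalence
  field
    P           : Mat a a
    Q           : Mat b b
    invertibleP : Invertible P
    invertibleQ : Invertible Q
    PAQ≐B       : (P ⊗ A) ⊗ Q ≐ B

≐⇒∼ : ∀ {a b} {A B : Mat a b} → A ≐ B → A ∼ B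
≐⇒∼ {A = A} A≐B = equivalence idM idM Invertible-id Invertible-id
  (≐-trans (⊗-identityʳ (idM ⊗ A)) (≐-trans (⊗-identityˡ A) A≐B))

∼-trans : ∀ {a b} {A B C : Mat a b} → A ∼ B → B ∼ C → A ∼ C
∼-trans {A = A} {B} {C} (equivalence P Q iP iQ PAQ) (equivalence P₂ Q₂ iP₂ iQ₂ PBQ) =
  equivalence (P₂ ⊗ P) (Q ⊗ Q₂) (Invertible-⊗ iP₂ iP) (Invertible-⊗ iQ iQ₂)
  (≐-trans (≐-sym (⊗-assoc ((P₂ ⊗ P) ⊗ A) Q Q₂))
    (≐-trans (⊗-congʳ Q₂ (≐-trans (⊗-congʳ Q (⊗-assoc P₂ P A))
      (≐-trans (⊗-assoc P₂ (P ⊗ A) Q) (⊗-congˡ P₂ PAQ)))) PBQ))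

∼-transpose : ∀ {a b} {A B : Mat a b} → A ∼ B → flip A ∼ flip B
∼-transpose {A = A} (equivalence P Q iP iQ PAQ) =
  equivalence (flip Q) (flip P) (Invertible-transpose iQ) (Invertible-transpose iP)
  (≐-trans (⊗-assoc (flip Q) (flip A) (flip P))
    (≐-trans (⊗-congˡ (flip Q) (≐-sym (⊗-transpose P A)))
      (≐-trans (≐-sym (⊗-transpose (P ⊗ A) Q)) (λ i j → PAQ j i))))

_∣∣_ : ∀ {a b} → ℤ → Mat a b → Set
c ∣∣ M = ∀ i j → c ∣ℤ M i j

∣-sum : ∀ {c} n {f : Fin n → ℤ} → (∀ i → c ∣ℤ f i) → c ∣ℤ sumℤ n f
∣-sum zero    c∣f = divides (+ 0) refl
∣-sum (suc n) c∣f = ℤ∣.∣m∣n⇒∣m+n (c∣f zero) (∣-sum n (c∣f ∘ suc))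

-- Entries of `B` are integer combinations of entries of `A`.
∣∣-∼ : ∀ {a b c} {A B : Mat a b} → A ∼ B → c ∣∣ A → c ∣∣ B
∣∣-∼ {a} {b} {A = A} (equivalence P Q _ _ PAQ) c∣A i j = subst (_ ∣ℤ_) (PAQ i j)
  (∣-sum b (λ k → ℤ∣.∣m⇒∣m*n (Q k j) (∣-sum a (λ l → ℤ∣.∣n⇒∣m*n (P i l) (c∣A l k)))))

-- The matrix 1 + u e_kᵀ, acting on all rows at once. When `u k` is 0 its inverse is obtained by
-- negating `u`. A single elementary operation and the clearing of a whole column are both
-- instances.
transvection : ∀ {m} → Fin m → (Fin m → ℤ) → Mat m m
transvection k u i l = idM i l ℤ.+ u i ℤ.* idM k l

transvection-⊗ : ∀ {a b} k u (M : Mat a b) →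
                 transvection k u ⊗ M ≐ λ i j → M i j ℤ.+ u i ℤ.* M k j
transvection-⊗ {a} k u M i j = begin
  sumℤ a (λ l → (idM i l ℤ.+ u i ℤ.* idM k l) ℤ.* M l j)
    ≡⟨ sum-cong a (λ l → identity (idM i l) (u i) (idM k l) (M l j)) ⟩
  sumℤ a (λ l → idM i l ℤ.* M l j ℤ.+ u i ℤ.* (idM k l ℤ.* M l j))
    ≡⟨ sum-+ a _ _ ⟩
  sumℤ a (λ l → idM i l ℤ.* M l j) ℤ.+ sumℤ a (λ l → u i ℤ.* (idM k l ℤ.* M l j))
    ≡⟨ cong₂ ℤ._+_ (sum-idMˡ i _) (trans (sum-*ˡ a (u i) _) (cong (u i ℤ.*_) (sum-idMˡ k _))) ⟩
  M i j ℤ.+ u i ℤ.* M k j ∎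
  where
  open ≡-Reasoning
  identity : ∀ x u y z → (x ℤ.+ u ℤ.* y) ℤ.* z ≡ x ℤ.* z ℤ.+ u ℤ.* (y ℤ.* z)
  identity = solve-∀

transvection-inverse : ∀ {m} (k : Fin m) u → u k ≡ + 0 →
                       transvection k u ⊗ transvection k (ℤ.-_ ∘ u) ≐ idM
transvection-inverse k u uk≡0 i j = begin
  (transvection k u ⊗ transvection k (ℤ.-_ ∘ u)) i j
    ≡⟨ transvection-⊗ k u (transvection k (ℤ.-_ ∘ u)) i j ⟩
  (idM i j ℤ.+ ℤ.- u i ℤ.* idM k j) ℤ.+ u i ℤ.* (idM k j ℤ.+ ℤ.- u k ℤ.* idM k j)
    ≡⟨ cong (λ e → (idM i j ℤ.+ ℤ.- u i ℤ.* idM k j) ℤ.+ u i ℤ.* (idM k j ℤ.+ ℤ.- e ℤ.* idM k j)) uk≡0 ⟩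
  (idM i j ℤ.+ ℤ.- u i ℤ.* idM k j) ℤ.+ u i ℤ.* (idM k j ℤ.+ ℤ.- (+ 0) ℤ.* idM k j)
    ≡⟨ identity (idM i j) (u i) (idM k j) ⟩
  idM i j ∎
  where
  open ≡-Reasoning
  identity : ∀ x u y → (x ℤ.+ ℤ.- u ℤ.* y) ℤ.+ u ℤ.* (y ℤ.+ (+ 0) ℤ.* y) ≡ x
  identity = solve-∀

Invertible-transvection : ∀ {m} (k : Fin m) u → u k ≡ + 0 → Invertible (transvection k u)
Invertible-transvection k u uk≡0 = transvection k (ℤ.-_ ∘ u) , transvection-inverse k u uk≡0 ,
  ≐-trans (⊗-congˡ (transvection k (ℤ.-_ ∘ u)) double-neg)
    (transvection-inverse k (ℤ.-_ ∘ u) (cong ℤ.-_ uk≡0))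
  where
  double-neg : transvection k u ≐ transvection k (ℤ.-_ ∘ ℤ.-_ ∘ u)
  double-neg i j = cong (λ e → idM i j ℤ.+ e ℤ.* idM k j) (sym (ℤ.neg-involutive (u i)))

row-op : ∀ {a b} (A : Mat a b) k u → u k ≡ + 0 → A ∼ λ i j → A i j ℤ.+ u i ℤ.* A k j
row-op A k u uk≡0 = equivalence (transvection k u) idM (Invertible-transvection k u uk≡0) Invertible-id
  (≐-trans (⊗-identityʳ _) (transvection-⊗ k u A))

col-op : ∀ {a b} (A : Mat a b) k u → u k ≡ + 0 → A ∼ λ i j → A i j ℤ.+ u j ℤ.* A i k
col-op A k u uk≡0 = ∼-transpose (row-op (flip A) k u uk≡0)

_⊕_ : ∀ {a b} → ℤ → Mat a b → Mat (suc a) (suc b)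
(x ⊕ M) zero    zero    = x
(x ⊕ M) zero    (suc j) = + 0
(x ⊕ M) (suc i) zero    = + 0
(x ⊕ M) (suc i) (suc j) = M i j

⊕-cong : ∀ {a b} {x y} {M K : Mat a b} → x ≡ y → M ≐ K → x ⊕ M ≐ y ⊕ K
⊕-cong x≡y M≐K zero    zero    = x≡y
⊕-cong x≡y M≐K zero    (suc j) = refl
⊕-cong x≡y M≐K (suc i) zero    = refl
⊕-cong x≡y M≐K (suc i) (suc j) = M≐K i j

⊕-⊗ : ∀ {a b c} x y (M : Mat a b) (K : Mat b c) → (x ⊕ M) ⊗ (y ⊕ K) ≐ (x ℤ.* y) ⊕ (M ⊗ K)
⊕-⊗ {b = b} x y M K zero    zero    =
  trans (cong (λ e → x ℤ.* y ℤ.+ e) (sum-zero b (λ k → refl))) (ℤ.+-identityʳ _)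
⊕-⊗ {b = b} x y M K zero    (suc j) =
  cong₂ ℤ._+_ (ℤ.*-zeroʳ x) (sum-zero b (λ k → ℤ.*-zeroˡ (K k j)))
⊕-⊗ {b = b} x y M K (suc i) zero    =
  cong₂ ℤ._+_ (ℤ.*-zeroˡ y) (sum-zero b (λ k → ℤ.*-zeroʳ (M i k)))
⊕-⊗ x y M K (suc i) (suc j) = ℤ.+-identityˡ _

idM-⊕ : ∀ {m} → (+ 1) ⊕ idM {m} ≐ idM
idM-⊕ zero    zero    = refl
idM-⊕ zero    (suc j) = refl
idM-⊕ (suc i) zero    = refl
idM-⊕ (suc i) (suc j) = sym (idM-suc i j)

Invertible-⊕ : ∀ {m} {x} {P : Mat m m} → x ℤ.* x ≡ + 1 → Invertible P → Invertible (x ⊕ P)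
Invertible-⊕ {x = x} {P} xx≡1 (P′ , PP′ , P′P) = x ⊕ P′ ,
  ≐-trans (⊕-⊗ x x P P′) (≐-trans (⊕-cong xx≡1 PP′) idM-⊕) ,
  ≐-trans (⊕-⊗ x x P′ P) (≐-trans (⊕-cong xx≡1 P′P) idM-⊕)

-- The unit `y` rescales the corner alone. It serves to replace a pivot by its absolute value, as
-- `Diag` has natural entries.
∼-⊕ : ∀ {a b} {x y} {A B : Mat a b} → y ℤ.* y ≡ + 1 → A ∼ B → x ⊕ A ∼ (y ℤ.* x) ⊕ B
∼-⊕ {x = x} {y} {A} yy≡1 (equivalence P Q iP iQ PAQ) =
  equivalence (y ⊕ P) ((+ 1) ⊕ Q) (Invertible-⊕ yy≡1 iP) (Invertible-⊕ refl iQ)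
  (≐-trans (⊗-congʳ ((+ 1) ⊕ Q) (⊕-⊗ y x P A))
    (≐-trans (⊕-⊗ (y ℤ.* x) (+ 1) (P ⊗ A) Q) (⊕-cong (ℤ.*-identityʳ (y ℤ.* x)) PAQ)))

-- Existence of the Smith normal form

HasDividingCorner : ∀ {a b} → Mat (suc a) (suc b) → Set
HasDividingCorner M = ∃ λ M′ → M ∼ M′ × M′ zero zero ∣∣ M′

HasDividingCorner-transpose : ∀ {a b} {M : Mat (suc a) (suc b)} →
                              HasDividingCorner (flip M) → HasDividingCorner M
HasDividingCorner-transpose (M′ , M∼M′ , M′∣) = flip M′ , ∼-transpose M∼M′ , flip M′∣

HasDividingCorner-∼ : ∀ {a b} {M K : Mat (suc a) (suc b)} → M ∼ K →
                      HasDividingCorner K → HasDividingCorner M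
HasDividingCorner-∼ M∼K (M′ , K∼M′ , M′∣) = M′ , ∼-trans M∼K K∼M′ , M′∣

-- If the entry at (i′, j) is t times the pivot at (i, j), adding 1 - t times row `i` to row `i′`
-- puts a copy of the pivot there. The last component is for a pivot that divides an entry of its
-- own row: an entry below or above it that the pivot fails to divide still escapes divisibility
-- after the move.
copy-entry : ∀ {a b} (M : Mat a b) i i′ j → M i j ∣ℤ M i′ j →
  ∃ λ M′ → M ∼ M′ × M′ i′ j ≡ M i j ×
           (∀ j′ → M i j ∣ℤ M i j′ → M i j ∣ℤ M′ i′ j′ → M i j ∣ℤ M i′ j′)
copy-entry M i i′ j (divides t eq) with i Fin.≟ i′
... | yes refl = M , ≐⇒∼ (λ _ _ → refl) , refl , λ _ _ x → x
... | no i≢i′ = _ , row-op M i u u≡0 , entry ,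
  λ j′ d d′ → ℤ∣.∣m+n∣n⇒∣m d′ (ℤ∣.∣n⇒∣m*n (u i′) d)
  where
  u : Fin _ → ℤ
  u l = idM i′ l ℤ.* (+ 1 ℤ.- t)

  u≡0 : u i ≡ + 0
  u≡0 = trans (cong (ℤ._* (+ 1 ℤ.- t)) (idM-off (i≢i′ ∘ sym))) (ℤ.*-zeroˡ (+ 1 ℤ.- t))

  identity : ∀ t m → t ℤ.* m ℤ.+ (+ 1) ℤ.* (+ 1 ℤ.- t) ℤ.* m ≡ m
  identity = solve-∀

  entry : M i′ j ℤ.+ u i′ ℤ.* M i j ≡ M i j
  entry = trans (cong₂ (λ x y → x ℤ.+ y ℤ.* (+ 1 ℤ.- t) ℤ.* M i j) eq (idM-diag i′))
                (identity t (M i j))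

-- Two copies, along column `j` into row zero and then along row zero into column zero, do the work
-- of row and column exchanges.
dividing-entry⇒corner : ∀ {a b} (M : Mat (suc a) (suc b)) i j → M i j ∣∣ M → HasDividingCorner M
dividing-entry⇒corner M i j M∣ =
  let M₁ , M∼M₁ , e₁ , _ = copy-entry M i zero j (M∣ zero j)
      M₁∣                = ∣∣-∼ M∼M₁ M∣
      M₂ , M₁∼M₂ , e₂ , _ = copy-entry (flip M₁) j zero zero
                              (subst (_∣ℤ M₁ zero zero) (sym e₁) (M₁∣ zero zero))
      M∼M₂ = ∼-trans M∼M₁ (∼-transpose M₁∼M₂)
  in flip M₂ , M∼M₂ , λ k l → subst (_∣ℤ M₂ l k) (sym (trans e₂ e₁)) (∣∣-∼ M∼M₂ M∣ k l)

-- Descent on the absolute value of the pivot. The hypothesis ranges over all shapes because a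
-- failure in a column is handled by transposing.
module _ (k : ℕ) (smaller : ∀ {a b} (M : Mat (suc a) (suc b)) i j →
                            M i j ≢ + 0 → ∣ M i j ∣ ℕ.< k → HasDividingCorner M) where

  -- Euclidean step: subtracting the quotient times column `j` from column `j′` leaves the remainder
  -- at (i, j′), nonzero by non-divisibility and smaller than the pivot.
  reduce-row : ∀ {a b} (M : Mat (suc a) (suc b)) i j j′ → M i j ≢ + 0 → ∣ M i j ∣ ≡ k →
               ¬ M i j ∣ℤ M i j′ → HasDividingCorner M
  reduce-row M i j j′ M≢0 M≡k M∤ =
    HasDividingCorner-∼ (col-op M j u u≡0) (smaller _ i j′
      (λ e → M∤ (divides quot (trans division (trans (cong (ℤ._+ quot ℤ.* M i j) (trans (sym remainder) e)) (ℤ.+-identityˡ _)))))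
      (subst₂ ℕ._<_ (cong ∣_∣ (sym remainder)) M≡k (ℤ.n%d<d (M i j′) (M i j))))
    where
    instance _ = ℤ.≢-nonZero M≢0
    quot = M i j′ ℤ./ M i j
    division = ℤ.a≡a%n+[a/n]*n (M i j′) (M i j)

    u : Fin _ → ℤ
    u l = idM j′ l ℤ.* (ℤ.- quot)

    j′≢j : j′ ≢ j
    j′≢j refl = M∤ ℤ∣.∣-refl

    u≡0 : u j ≡ + 0
    u≡0 = trans (cong (ℤ._* (ℤ.- quot)) (idM-off j′≢j)) (ℤ.*-zeroˡ (ℤ.- quot))

    identity : ∀ r t m → (r ℤ.+ t ℤ.* m) ℤ.+ (+ 1) ℤ.* (ℤ.- t) ℤ.* m ≡ r
    identity = solve-∀

    remainder : M i j′ ℤ.+ u j′ ℤ.* M i j ≡ + (M i j′ ℤ.% M i j)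
    remainder = trans
      (cong₂ (λ x y → x ℤ.+ y ℤ.* (ℤ.- quot) ℤ.* M i j) division (idM-diag j′))
      (identity _ quot (M i j))

  -- An entry outside the row and column of the pivot that escapes divisibility is treated by
  -- copying the pivot into its row, where the row case applies. If no entry escapes, the pivot can
  -- go to the corner.
  reduce : ∀ {a b} (M : Mat (suc a) (suc b)) i j → M i j ≢ + 0 → ∣ M i j ∣ ≡ k → HasDividingCorner M
  reduce M i j M≢0 M≡k with Fin.any? (λ j′ → ¬? (M i j ℤ∣.∣? M i j′))
  ... | yes (j′ , M∤) = reduce-row M i j j′ M≢0 M≡k M∤
  ... | no row∣ with Fin.any? (λ i′ → ¬? (M i j ℤ∣.∣? M i′ j))
  ...   | yes (i′ , M∤) = HasDividingCorner-transpose (reduce-row (flip M) j i i′ M≢0 M≡k M∤)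
  ...   | no col∣ with Fin.any? (λ i′ → Fin.any? (λ j′ → ¬? (M i j ℤ∣.∣? M i′ j′)))
  ...     | no all∣ = dividing-entry⇒corner M i j (λ i′ j′ →
            decidable-stable (M i j ℤ∣.∣? M i′ j′) (λ M∤ → all∣ (i′ , j′ , M∤)))
  ...     | yes (i′ , j′ , M∤) =
            let M₁ , M∼M₁ , e , back = copy-entry M i i′ j
                  (decidable-stable (M i j ℤ∣.∣? M i′ j) (λ x → col∣ (i′ , x)))
                M∣row = decidable-stable (M i j ℤ∣.∣? M i j′) (λ x → row∣ (j′ , x))
            in HasDividingCorner-∼ M∼M₁ (reduce-row M₁ i′ j j′
                 (M≢0 ∘ trans (sym e)) (trans (cong ∣_∣ e) M≡k)
                 (λ d → M∤ (back j′ M∣row (subst (_∣ℤ M₁ i′ j′) e d))))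

nonzero⇒dividing-corner : ∀ {a b} (M : Mat (suc a) (suc b)) i j → M i j ≢ + 0 → HasDividingCorner M
nonzero⇒dividing-corner M i j M≢0 = go M i j M≢0 (<-wellFounded _)
  where
  go : ∀ {a b} (M : Mat (suc a) (suc b)) i j → M i j ≢ + 0 → Acc ℕ._<_ ∣ M i j ∣ → HasDividingCorner M
  go M i j M≢0 (acc rec) =
    reduce ∣ M i j ∣ (λ M′ i′ j′ ≢0 lt → go M′ i′ j′ ≢0 (rec lt)) M i j M≢0 refl

dividing-corner⇒⊕ : ∀ {a b} (M : Mat (suc a) (suc b)) → M zero zero ∣∣ M →
                    ∃ λ M′ → M ∼ M zero zero ⊕ M′
dividing-corner⇒⊕ M M∣ = _ , ∼-trans (row-op M zero u refl) (∼-trans (col-op M₁ zero w refl) (≐⇒∼ shape))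
  where
  u w : Fin _ → ℤ
  u zero    = + 0
  u (suc i) = ℤ.- ℤ∣.quotient (M∣ (suc i) zero)
  w zero    = + 0
  w (suc j) = ℤ.- ℤ∣.quotient (M∣ zero (suc j))

  M₁ : Mat _ _
  M₁ i j = M i j ℤ.+ u i ℤ.* M zero j

  cancel : ∀ t m → t ℤ.* m ℤ.+ ℤ.- t ℤ.* m ≡ + 0
  cancel = solve-∀

  add0 : ∀ x y → x ℤ.+ (+ 0) ℤ.* y ≡ x
  add0 = solve-∀

  col-cleared : ∀ i → M₁ (suc i) zero ≡ + 0
  col-cleared i with divides t eq ← M∣ (suc i) zero =
    trans (cong (ℤ._+ ℤ.- t ℤ.* M zero zero) eq) (cancel t (M zero zero))

  row-cleared : ∀ j → M zero (suc j) ℤ.+ w (suc j) ℤ.* M zero zero ≡ + 0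
  row-cleared j with divides t eq ← M∣ zero (suc j) =
    trans (cong (ℤ._+ ℤ.- t ℤ.* M zero zero) eq) (cancel t (M zero zero))

  shape : (λ i j → M₁ i j ℤ.+ w j ℤ.* M₁ i zero) ≐
          M zero zero ⊕ (λ i j → M₁ (suc i) (suc j) ℤ.+ w (suc j) ℤ.* M₁ (suc i) zero)
  shape zero    zero    = trans (add0 _ (M₁ zero zero)) (add0 (M zero zero) (M zero zero))
  shape zero    (suc j) = trans
    (cong₂ (λ x y → x ℤ.+ w (suc j) ℤ.* y) (add0 (M zero (suc j)) (M zero (suc j))) (add0 (M zero zero) (M zero zero)))
    (row-cleared j)
  shape (suc i) zero    = trans (add0 _ (M₁ (suc i) zero)) (col-cleared i)
  shape (suc i) (suc j) = refl

Diag-∷ : ∀ {a b} x (d : Fin b → ℕ) → (+ x) ⊕ Diag {a} d ≐ Diag (x ∷ d)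
Diag-∷ x d zero    zero    = refl
Diag-∷ x d zero    (suc j) = refl
Diag-∷ x d (suc i) zero    = refl
Diag-∷ x d (suc i) (suc j) with toℕ i ℕ.≟ toℕ j | toℕ (suc i) ℕ.≟ toℕ (suc j)
... | yes _ | yes _ = refl
... | yes p | no ¬p = contradiction (cong suc p) ¬p
... | no ¬p | yes p = contradiction (ℕ.suc-injective p) ¬p
... | no _  | no _  = refl

Diag-0 : ∀ {a b} → (λ _ _ → + 0) ≐ Diag {a} {b} (λ _ → 0)
Diag-0 i j with toℕ i ℕ.≟ toℕ j
... | yes _ = refl
... | no  _ = refl

sign-unit : ∀ x → ∃ λ y → y ℤ.* y ≡ + 1 × y ℤ.* x ≡ + ∣ x ∣
sign-unit (+ n)        = + 1 , refl , ℤ.*-identityˡ (+ n)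
sign-unit (ℤ.-[1+ n ]) = ℤ.-[1+ 0 ] , refl , ℤ.-1*i≡-i (ℤ.-[1+ n ])

DivisorChain : ∀ {v} → (Fin v → ℕ) → Set
DivisorChain {v} d = ∀ (i j : Fin v) → suc (toℕ i) ≡ toℕ j → d i ∣ d j

DivisorChain-∷ : ∀ {v} x (d : Fin v → ℕ) → (∀ j → x ∣ d j) → DivisorChain d → DivisorChain (x ∷ d)
DivisorChain-∷ x d x∣d chain zero    (suc j) _ = x∣d j
DivisorChain-∷ x d x∣d chain (suc i) (suc j) e = chain i j (ℕ.suc-injective e)

-- The bound on common divisors is what makes the induction produce a divisor chain
-- even in the columns beyond the last row.
record SmithForm {a b} (A : Mat a b) : Set where
  field
    d        : Fin b → ℕ
    A∼Diag   : A ∼ Diag d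
    chain    : DivisorChain d
    greatest : ∀ c → (+ c) ∣∣ A → ∀ j → c ∣ d j

SmithForm-0 : ∀ {a b} {A : Mat a b} → A ≐ (λ _ _ → + 0) → SmithForm A
SmithForm-0 A≐0 = record
  { d        = λ _ → 0
  ; A∼Diag   = ≐⇒∼ (≐-trans A≐0 Diag-0)
  ; chain    = λ _ _ _ → 0 ℕ∣.∣0
  ; greatest = λ c _ _ → c ℕ∣.∣0
  }

SmithForm-⊕ : ∀ {a b} {A : Mat (suc a) (suc b)} x {M : Mat a b} → A ∼ x ⊕ M → x ∣∣ M →
              SmithForm M → SmithForm A
SmithForm-⊕ {A = A} x {M} A∼⊕ x∣M SM = record
  { d        = ∣ x ∣ ∷ d
  ; A∼Diag   = let y , yy≡1 , yx≡∣x∣ = sign-unit x in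
      ∼-trans A∼⊕ (∼-trans (∼-⊕ {x = x} {y} yy≡1 A∼Diag)
        (≐⇒∼ (≐-trans (⊕-cong yx≡∣x∣ (λ _ _ → refl)) (Diag-∷ ∣ x ∣ d))))
  -- The pivot divides the remaining block, so `greatest` makes it divide every later factor.
  ; chain    = DivisorChain-∷ ∣ x ∣ d
      (greatest ∣ x ∣ (λ i j → ℤ∣.∣-trans ℤ∣.∣m∣∣m (x∣M i j))) chain
  ; greatest = greatest′
  }
  where
  open SmithForm SM

  greatest′ : ∀ c → (+ c) ∣∣ A → ∀ j → c ∣ (∣ x ∣ ∷ d) j
  greatest′ c c∣A zero    = ℤ∣.∣⇒∣ᵤ (∣∣-∼ A∼⊕ c∣A zero zero)
  greatest′ c c∣A (suc j) = greatest c (λ k l → ∣∣-∼ A∼⊕ c∣A (suc k) (suc l)) j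

smithForm : ∀ a b (A : Mat a b) → SmithForm A
smithForm-nonzero : ∀ {a b} (A : Mat (suc a) (suc b)) → HasDividingCorner A → SmithForm A

smithForm zero    b       A = SmithForm-0 (λ ())
smithForm (suc a) zero    A = SmithForm-0 (λ _ ())
smithForm (suc a) (suc b) A with Fin.any? (λ i → Fin.any? (λ j → ¬? (A i j ℤ.≟ + 0)))
... | no A≡0 = SmithForm-0 (λ i j → decidable-stable (A i j ℤ.≟ + 0) (λ x → A≡0 (i , j , x)))
... | yes (i , j , A≢0) = smithForm-nonzero A (nonzero⇒dividing-corner A i j A≢0)

smithForm-nonzero A (M , A∼M , M∣M) =
  let M′ , M∼⊕ = dividing-corner⇒⊕ M M∣M
  in SmithForm-⊕ (M zero zero) (∼-trans A∼M M∼⊕)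
       (λ i j → ∣∣-∼ M∼⊕ M∣M (suc i) (suc j)) (smithForm _ _ M′)

smith-form-exists : ∀ {a b} (A : Mat a b) → Σ (Fin b → ℕ) (IsSmithForm A)
smith-form-exists A = d , P , Q , invertibleP , invertibleQ , PAQ≐B , chain
  where
  open SmithForm (smithForm _ _ A)
  open _∼_ A∼Diag

-- Invariant factors of a matrix whose row lattice is pinched by a congruence lattice

_◁_ : ∀ {a b} → (Fin a → ℤ) → Mat a b → Fin b → ℤ
_◁_ {a} y M j = sumℤ a (λ i → y i ℤ.* M i j)

RowLattice : ∀ {a b} → Mat a b → (Fin b → ℤ) → Set
RowLattice {a} A x = Σ (Fin a → ℤ) λ y → ∀ j → x j ≡ (y ◁ A) j

Diag-divisible : ∀ {a b} (d : Fin b → ℕ) (i : Fin a) j → (+ d j) ∣ℤ Diag d i j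
Diag-divisible d i j with toℕ i ℕ.≟ toℕ j
... | yes _ = ℤ∣.∣-refl
... | no  _ = divides (+ 0) refl

Diag-off : ∀ {a b} (d : Fin b → ℕ) (i : Fin a) j → toℕ i ≢ toℕ j → Diag d i j ≡ + 0
Diag-off d i j i≢j with toℕ i ℕ.≟ toℕ j
... | yes p = contradiction p i≢j
... | no  _ = refl

Diag-diag : ∀ {a b} (d : Fin b → ℕ) (i : Fin a) j → toℕ i ≡ toℕ j → Diag d i j ≡ + d j
Diag-diag d i j i≡j with toℕ i ℕ.≟ toℕ j
... | yes _ = refl
... | no ¬p = contradiction i≡j ¬p

DivisorChain-≤ : ∀ {v} {d : Fin v → ℕ} → DivisorChain d →
                 ∀ i j → toℕ i ℕ.≤′ toℕ j → d i ∣ d j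
DivisorChain-≤ {v} {d} chain i j i≤j = go j i≤j refl
  where
  go : ∀ j {m} → toℕ i ℕ.≤′ m → m ≡ toℕ j → d i ∣ d j
  go j (ℕ.≤′-reflexive e) e′ = ℕ∣.∣-reflexive (cong d (Fin.toℕ-injective (trans e e′)))
  go j (ℕ.≤′-step {m} i≤m) e =
    ℕ∣.∣-trans (go (Fin.fromℕ< m<v) i≤m (sym (Fin.toℕ-fromℕ< m<v)))
               (chain _ j (trans (cong suc (Fin.toℕ-fromℕ< m<v)) e))
    where
    m<v : m ℕ.< v
    m<v = ℕ.<-trans (subst (m ℕ.<_) e (ℕ.n<1+n m)) (Fin.toℕ<n j)

-- For a row lattice L with sK ⊆ L ⊆ K, where K = {x : g ∣ Σ x}: the functional Σ becomes
-- φ in the basis given by the rows of Q⁻¹, and φ is unimodular. Since φₖeⱼ - φⱼeₖ lies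
-- in K, every dⱼ divides sφₖ for k ≠ j.
module PinchedLattice {N v} (A : Mat N v) (s g : ℕ) .{{_ : ℕ.NonZero s}} .{{_ : ℕ.NonZero g}}
  (contains : ∀ x → (+ g) ∣ℤ sumℤ v x → RowLattice A (λ j → + s ℤ.* x j))
  (contained : ∀ {x} → RowLattice A x → (+ g) ∣ℤ sumℤ v x)
  (d : Fin v → ℕ) (smith : IsSmithForm A d) where

  private
    P = proj₁ smith
    Q = proj₁ (proj₂ smith)
    P′ = proj₁ (proj₁ (proj₂ (proj₂ smith)))
    P′P = proj₂ (proj₂ (proj₁ (proj₂ (proj₂ smith))))
    invQ = proj₁ (proj₂ (proj₂ (proj₂ smith)))
    Q′ = proj₁ invQ
    QQ′ = proj₁ (proj₂ invQ)
    Q′Q = proj₂ (proj₂ invQ)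
    PAQ = proj₁ (proj₂ (proj₂ (proj₂ (proj₂ smith))))
    chain = proj₂ (proj₂ (proj₂ (proj₂ (proj₂ smith))))

  φ : Fin v → ℤ
  φ k = sumℤ v (Q′ k)

  sum-◁Q′ : ∀ u → sumℤ v (u ◁ Q′) ≡ sumℤ v (λ k → u k ℤ.* φ k)
  sum-◁Q′ u = trans (sum-swap v v (λ m k → u k ℤ.* Q′ k m)) (sum-cong v (λ k → sum-*ˡ v (u k) (Q′ k)))

  -- φ is Q⁻¹ applied to the all-ones vector, so Qφ is the all-ones vector again.
  φ-unimodular : ∀ j → sumℤ v (λ k → Q j k ℤ.* φ k) ≡ + 1
  φ-unimodular j = begin
    sumℤ v (λ k → Q j k ℤ.* φ k)  ≡⟨ sum-◁Q′ (Q j) ⟨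
    sumℤ v (Q j ◁ Q′)             ≡⟨ sum-cong v (QQ′ j) ⟩
    sumℤ v (idM j)                ≡⟨ sum-cong v (λ k → sym (ℤ.*-identityʳ (idM j k))) ⟩
    sumℤ v (λ k → idM j k ℤ.* + 1) ≡⟨ sum-idMˡ j (λ _ → + 1) ⟩
    + 1                           ∎
    where open ≡-Reasoning

  -- Row `j` of `Q` writes `x` as an integer combination of the multiples xφₖ.
  ∣φ⇒∣ : ∀ {c} x → Fin v → (∀ k → c ∣ℤ x ℤ.* φ k) → c ∣ℤ x
  ∣φ⇒∣ {c} x j c∣ = subst (c ∣ℤ_) eq
    (∣-sum v (λ k → ℤ∣.∣n⇒∣m*n (Q j k) (c∣ k)))
    where
    open ≡-Reasoning
    identity : ∀ a b c → a ℤ.* (b ℤ.* c) ≡ b ℤ.* (a ℤ.* c)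
    identity = solve-∀
    eq : sumℤ v (λ k → Q j k ℤ.* (x ℤ.* φ k)) ≡ x
    eq = begin
      sumℤ v (λ k → Q j k ℤ.* (x ℤ.* φ k))  ≡⟨ sum-cong v (λ k → identity (Q j k) x (φ k)) ⟩
      sumℤ v (λ k → x ℤ.* (Q j k ℤ.* φ k))  ≡⟨ sum-*ˡ v x _ ⟩
      x ℤ.* sumℤ v (λ k → Q j k ℤ.* φ k)    ≡⟨ cong (x ℤ.*_) (φ-unimodular j) ⟩
      x ℤ.* + 1                             ≡⟨ ℤ.*-identityʳ x ⟩
      x                                     ∎

  -- If x = yA, then xQ = (yP⁻¹)(PAQ): the new coordinates of a lattice vector form a combination of
  -- the rows of `Diag d`.
  lattice-coordinates : ∀ {x} → RowLattice A x → ∃ λ w → ∀ j → (x ◁ Q) j ≡ (w ◁ Diag d) j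
  lattice-coordinates {x} (y , x≡yA) = (y ◁ P′) , coordinates zero
    where
    X : Mat 1 v
    X _ = x
    Y : Mat 1 N
    Y _ = y
    coordinates : X ⊗ Q ≐ (Y ⊗ P′) ⊗ Diag d
    coordinates = ≐-trans
      (⊗-congʳ Q (≐-trans (λ _ → x≡yA) (≐-sym (⊗-cancel-inner Y A P′P))))
      (≐-trans (⊗-assoc (Y ⊗ P′) (P ⊗ A) Q) (⊗-congˡ (Y ⊗ P′) PAQ))

  -- `u` lists the coordinates of a vector x of K in the basis formed by the rows of Q⁻¹. Then sx
  -- lies in the row lattice, which constrains its coordinates su.
  module _ (u : Fin v → ℤ) (g∣ : (+ g) ∣ℤ sumℤ v (λ k → u k ℤ.* φ k)) where
    private
      x : Fin v → ℤ
      x = u ◁ Q′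

      L = lattice-coordinates (contains x (subst (_ ∣ℤ_) (sym (sum-◁Q′ u)) g∣))

      su≡ : ∀ j → + s ℤ.* u j ≡ (proj₁ L ◁ Diag d) j
      su≡ j = trans (sym eq) (proj₂ L j)
        where
        U : Mat 1 v
        U _ = u
        open ≡-Reasoning
        eq : ((λ k → + s ℤ.* x k) ◁ Q) j ≡ + s ℤ.* u j
        eq = begin
          sumℤ v (λ k → + s ℤ.* x k ℤ.* Q k j)   ≡⟨ sum-cong v (λ k → ℤ.*-assoc (+ s) (x k) (Q k j)) ⟩
          sumℤ v (λ k → + s ℤ.* (x k ℤ.* Q k j)) ≡⟨ sum-*ˡ v (+ s) _ ⟩
          + s ℤ.* (x ◁ Q) j                      ≡⟨ cong (+ s ℤ.*_) (⊗-assoc U Q′ Q zero j) ⟩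
          + s ℤ.* (U ⊗ (Q′ ⊗ Q)) zero j          ≡⟨ cong (+ s ℤ.*_) (⊗-congˡ U Q′Q zero j) ⟩
          + s ℤ.* (U ⊗ idM) zero j               ≡⟨ cong (+ s ℤ.*_) (⊗-identityʳ U zero j) ⟩
          + s ℤ.* u j                            ∎

    d∣s* : ∀ j → (+ d j) ∣ℤ + s ℤ.* u j
    d∣s* j = subst (_ ∣ℤ_) (sym (su≡ j))
      (∣-sum N (λ i → ℤ∣.∣n⇒∣m*n (proj₁ L i) (Diag-divisible d i j)))

    -- A column with no row of the same index is zero in `Diag d`. This later excludes fewer rows
    -- than columns.
    s*≡0 : ∀ j → N ℕ.≤ toℕ j → + s ℤ.* u j ≡ + 0
    s*≡0 j N≤j = trans (su≡ j) (sum-zero N (λ i → trans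
      (cong (proj₁ L i ℤ.*_) (Diag-off d i j (ℕ.<⇒≢ (ℕ.<-≤-trans (Fin.toℕ<n i) N≤j))))
      (ℤ.*-zeroʳ (proj₁ L i))))

  d∣sφ : ∀ j k → j ≢ k → (+ d j) ∣ℤ + s ℤ.* φ k
  d∣sφ j k j≢k = subst (λ e → (+ d j) ∣ℤ + s ℤ.* e) uj≡φk (d∣s* u (divides (+ 0) sum≡0) j)
    where
    u : Fin v → ℤ
    u l = φ k ℤ.* idM j l ℤ.+ (ℤ.- φ j) ℤ.* idM k l

    open ≡-Reasoning
    expand : ∀ a b c e f → (a ℤ.* b ℤ.+ c ℤ.* e) ℤ.* f ≡ a ℤ.* (b ℤ.* f) ℤ.+ c ℤ.* (e ℤ.* f)
    expand = solve-∀
    cancel : ∀ a b → a ℤ.* b ℤ.+ (ℤ.- b) ℤ.* a ≡ + 0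
    cancel = solve-∀
    simplify : ∀ a b → a ℤ.* + 1 ℤ.+ b ℤ.* + 0 ≡ a
    simplify = solve-∀

    uj≡φk : u j ≡ φ k
    uj≡φk = trans
      (cong₂ (λ x y → φ k ℤ.* x ℤ.+ (ℤ.- φ j) ℤ.* y) (idM-diag j) (idM-off (j≢k ∘ sym)))
      (simplify (φ k) (ℤ.- φ j))

    sum≡0 : sumℤ v (λ l → u l ℤ.* φ l) ≡ + 0
    sum≡0 = begin
      sumℤ v (λ l → u l ℤ.* φ l)
        ≡⟨ sum-cong v (λ l → expand (φ k) (idM j l) (ℤ.- φ j) (idM k l) (φ l)) ⟩
      sumℤ v (λ l → φ k ℤ.* (idM j l ℤ.* φ l) ℤ.+ (ℤ.- φ j) ℤ.* (idM k l ℤ.* φ l))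
        ≡⟨ sum-+ v _ _ ⟩
      sumℤ v (λ l → φ k ℤ.* (idM j l ℤ.* φ l)) ℤ.+ sumℤ v (λ l → (ℤ.- φ j) ℤ.* (idM k l ℤ.* φ l))
        ≡⟨ cong₂ ℤ._+_ (sum-*ˡ v (φ k) _) (sum-*ˡ v (ℤ.- φ j) _) ⟩
      φ k ℤ.* sumℤ v (λ l → idM j l ℤ.* φ l) ℤ.+ (ℤ.- φ j) ℤ.* sumℤ v (λ l → idM k l ℤ.* φ l)
        ≡⟨ cong₂ (λ x y → φ k ℤ.* x ℤ.+ (ℤ.- φ j) ℤ.* y) (sum-idMˡ j φ) (sum-idMˡ k φ) ⟩
      φ k ℤ.* φ j ℤ.+ (ℤ.- φ j) ℤ.* φ k
        ≡⟨ cancel (φ k) (φ j) ⟩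
      + 0 ∎

  -- By unimodularity it suffices that dᵢ divides every sφₖ. The pairwise argument `d∣sφ` leaves out
  -- k = i. There dᵢ divides dᵢ₊₁, which divides sφᵢ, and this is where a successor index is
  -- required.
  non-last-∣ : ∀ i → suc (toℕ i) ≢ v → d i ∣ s
  non-last-∣ i i≢last = ℤ∣.∣⇒∣ᵤ (∣φ⇒∣ (+ s) i d∣)
    where
    i+1<v : suc (toℕ i) ℕ.< v
    i+1<v = ℕ.≤∧≢⇒< (Fin.toℕ<n i) i≢last

    i′ = Fin.fromℕ< i+1<v

    i′≢i : i′ ≢ i
    i′≢i e = ℕ.1+n≢n (trans (sym (Fin.toℕ-fromℕ< i+1<v)) (cong toℕ e))

    d∣ : ∀ k → (+ d i) ∣ℤ + s ℤ.* φ k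
    d∣ k with i Fin.≟ k
    ... | no i≢k   = d∣sφ i k i≢k
    ... | yes refl = ℤ∣.∣-trans (ℤ∣.∣ᵤ⇒∣ (chain i i′ (sym (Fin.toℕ-fromℕ< i+1<v)))) (d∣sφ i′ i i′≢i)

  module _ (l : Fin v) (last : suc (toℕ l) ≡ v) where
    private
      -- `g` times the last basis vector has coordinate sum gφ_l, hence lies in K; its image under
      -- `s` ties the last factor to sg.
      u : Fin v → ℤ
      u k = idM l k ℤ.* + g

      ul≡g : u l ≡ + g
      ul≡g = trans (cong (ℤ._* + g) (idM-diag l)) (ℤ.*-identityˡ (+ g))

      g∣u : (+ g) ∣ℤ sumℤ v (λ k → u k ℤ.* φ k)
      g∣u = ∣-sum v (λ k → ℤ∣.∣m⇒∣m*n (φ k) (divides (idM l k) refl))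

      -- Otherwise the last column of `Diag d` would vanish, forcing sg = 0.
      v≤N : v ℕ.≤ N
      v≤N with N ℕ.≤? toℕ l
      ... | no N≰l  = subst (ℕ._≤ N) last (ℕ.≰⇒> N≰l)
      ... | yes N≤l = contradiction
        (trans (ℤ.pos-* s g) (trans (cong (+ s ℤ.*_) (sym ul≡g)) (s*≡0 u g∣u l N≤l)))
        (ℕ.≢-nonZero⁻¹ (s ℕ.* g) {{ℕ.m*n≢0 s g}} ∘ ℤ.+-injective)

      -- Row `j` of PA lies in the lattice, so `g` divides its sum. Its new coordinates are dⱼ times
      -- a unit vector, so that sum is dⱼφⱼ. The row exists because v ≤ N.
      g∣dφ : ∀ j → (+ g) ∣ℤ + d j ℤ.* φ j
      g∣dφ j = subst (_ ∣ℤ_) sum-x (contained (P i , λ _ → refl))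
        where
        j<N = ℕ.<-≤-trans (Fin.toℕ<n j) v≤N
        i = Fin.fromℕ< j<N
        x = P i ◁ A
        X : Mat 1 v
        X _ = x

        open ≡-Reasoning
        xQ≡ : ∀ k → (x ◁ Q) k ≡ + d j ℤ.* idM j k
        xQ≡ k with j Fin.≟ k
        ... | yes refl = begin
          (x ◁ Q) j         ≡⟨ PAQ i j ⟩
          Diag d i j        ≡⟨ Diag-diag d i j (Fin.toℕ-fromℕ< j<N) ⟩
          + d j             ≡⟨ ℤ.*-identityʳ (+ d j) ⟨
          + d j ℤ.* + 1     ≡⟨ cong (+ d j ℤ.*_) (idM-diag j) ⟨
          + d j ℤ.* idM j j ∎
        ... | no j≢k = begin
          (x ◁ Q) k         ≡⟨ PAQ i k ⟩
          Diag d i k        ≡⟨ Diag-off d i k (j≢k ∘ Fin.toℕ-injective ∘ trans (sym (Fin.toℕ-fromℕ< j<N))) ⟩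
          + 0               ≡⟨ ℤ.*-zeroʳ (+ d j) ⟨
          + d j ℤ.* + 0     ≡⟨ cong (+ d j ℤ.*_) (idM-off j≢k) ⟨
          + d j ℤ.* idM j k ∎

        sum-x : sumℤ v x ≡ + d j ℤ.* φ j
        sum-x = begin
          sumℤ v x                      ≡⟨ sum-cong v (λ k → sym (⊗-identityʳ X zero k)) ⟩
          sumℤ v ((X ⊗ idM) zero)       ≡⟨ sum-cong v (λ k → sym (⊗-congˡ X QQ′ zero k)) ⟩
          sumℤ v ((X ⊗ (Q ⊗ Q′)) zero)  ≡⟨ sum-cong v (λ k → sym (⊗-assoc X Q Q′ zero k)) ⟩
          sumℤ v ((x ◁ Q) ◁ Q′)         ≡⟨ sum-◁Q′ (x ◁ Q) ⟩
          sumℤ v (λ k → (x ◁ Q) k ℤ.* φ k)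
            ≡⟨ sum-cong v (λ k → trans (cong (ℤ._* φ k) (xQ≡ k)) (ℤ.*-assoc (+ d j) (idM j k) (φ k))) ⟩
          sumℤ v (λ k → + d j ℤ.* (idM j k ℤ.* φ k))
            ≡⟨ sum-*ˡ v (+ d j) _ ⟩
          + d j ℤ.* sumℤ v (λ k → idM j k ℤ.* φ k)
            ≡⟨ cong (+ d j ℤ.*_) (sum-idMˡ j φ) ⟩
          + d j ℤ.* φ j                 ∎

    -- Every dₖ divides the last factor, so `g` divides d_l φₖ for all k, and unimodularity removes
    -- φₖ.
    g∣last : g ∣ d l
    g∣last = ℤ∣.∣⇒∣ᵤ (∣φ⇒∣ (+ d l) l (λ k → ℤ∣.∣-trans (g∣dφ k)
      (ℤ∣.*-monoˡ-∣ (φ k) {+ d k} {+ d l} (ℤ∣.∣ᵤ⇒∣ (DivisorChain-≤ chain k l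
        (ℕ.≤⇒≤′ (ℕ.s≤s⁻¹ (subst (toℕ k ℕ.<_) (sym last) (Fin.toℕ<n k)))))))))

    last∣sg : d l ∣ s ℕ.* g
    last∣sg = ℤ∣.∣⇒∣ᵤ (subst ((+ d l) ∣ℤ_) (trans (cong (+ s ℤ.*_) ul≡g) (sym (ℤ.pos-* s g))) (d∣s* u g∣u l))

    last≡ : ∃ λ t → d l ≡ t ℕ.* g × t ∣ s
    last≡ = ℕ∣.quotient g∣last , ℕ∣._∣_.equality g∣last ,
      ℕ∣.*-cancelʳ-∣ g (subst (_∣ s ℕ.* g) (ℕ∣._∣_.equality g∣last) last∣sg)

-- Indicators and linear algebra over a finite field

sum-const : ∀ m c → sumℤ m (λ _ → + c) ≡ + (m ℕ.* c)
sum-const zero    c = refl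
sum-const (suc m) c = cong (λ e → + c ℤ.+ e) (sum-const m c)

-- The shape of an entry condition in `IsIncidence`, so that matrix entries and decided membership
-- can be compared directly.
IsIndicator : ℤ → Set → Set
IsIndicator z P = (z ≡ + 1 × P) ⊎ (z ≡ + 0 × ¬ P)

module _ {P : Set} where

  indicator : Dec P → ℤ
  indicator (yes _) = + 1
  indicator (no  _) = + 0

  indicator-correct : (P? : Dec P) → IsIndicator (indicator P?) P
  indicator-correct (yes p) = inj₁ (refl , p)
  indicator-correct (no ¬p) = inj₂ (refl , ¬p)

  indicator-1 : ∀ {z} → IsIndicator z P → P → z ≡ + 1
  indicator-1 (inj₁ (e , _))  p = e
  indicator-1 (inj₂ (_ , ¬p)) p = contradiction p ¬p

  indicator-0 : ∀ {z} → IsIndicator z P → ¬ P → z ≡ + 0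
  indicator-0 (inj₁ (_ , p)) ¬p = contradiction p ¬p
  indicator-0 (inj₂ (e , _)) ¬p = e

  indicator-map : ∀ {Q : Set} {z} → (P → Q) → (Q → P) → IsIndicator z P → IsIndicator z Q
  indicator-map f g (inj₁ (e , p))  = inj₁ (e , f p)
  indicator-map f g (inj₂ (e , ¬p)) = inj₂ (e , ¬p ∘ g)

indicator-unique : ∀ {P Q : Set} {z z′} → (P → Q) → (Q → P) →
                   IsIndicator z P → IsIndicator z′ Q → z ≡ z′
indicator-unique f g (inj₁ (refl , p))  ind = sym (indicator-1 ind (f p))
indicator-unique f g (inj₂ (refl , ¬p)) ind = sym (indicator-0 ind (¬p ∘ g))

funToFin-cong : ∀ {m n} {f g : Fin m → Fin n} → f ≗ g → Fin.funToFin f ≡ Fin.funToFin g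
funToFin-cong {zero}  f≗g = refl
funToFin-cong {suc m} f≗g = cong₂ Fin.combine (f≗g zero) (funToFin-cong (f≗g ∘ suc))

module LinearAlgebra {q : ℕ} (𝔽 : FiniteField q) where

  open FiniteField 𝔽 public
    using (F; 0#; 1#; 0≢1; inverse; card; isCommRing)
    renaming (_+_ to infixl 6 _∔_; _*_ to infixl 7 _·_; -_ to infix 8 ⊖_)

  commutativeRing : CommutativeRing 0ℓ 0ℓ
  commutativeRing = record { isCommutativeRing = isCommRing }

  open CommutativeRing commutativeRing public using
    ( +-assoc; +-comm; +-identityˡ; +-identityʳ; -‿inverseˡ; -‿inverseʳ
    ; *-assoc; *-identityˡ; zeroˡ; distribʳ)
  open RingProperties (CommutativeRing.ring commutativeRing) public using (-‿distribˡ-*)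
  open SemiringSolver (CommutativeRing.commutativeSemiring commutativeRing) public
    using (solve; _:+_; _:*_; _:=_)
  module ΣF = FiniteSum isCommRing (sumF 𝔽) (λ _ → refl) (λ _ _ → refl)

  open Inverse card public using (to; from)

  from-to : ∀ x → from (to x) ≡ x
  from-to = Inverse.strictlyInverseʳ card

  to-from : ∀ t → to (from t) ≡ t
  to-from = Inverse.strictlyInverseˡ card

  from-injective : ∀ {t t′} → from t ≡ from t′ → t ≡ t′
  from-injective {t} {t′} e = trans (sym (to-from t)) (trans (cong to e) (to-from t′))

  infix 4 _≟F_
  _≟F_ : ∀ (x y : F) → Dec (x ≡ y)
  x ≟F y = map′ (λ e → trans (sym (from-to x)) (trans (cong from e) (from-to y))) (cong to) (to x Fin.≟ to y)

  x∔⊖y≡0⇒x≡y : ∀ x y → x ∔ ⊖ y ≡ 0# → x ≡ y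
  x∔⊖y≡0⇒x≡y x y e = begin
    x                ≡⟨ +-identityʳ x ⟨
    x ∔ 0#           ≡⟨ cong (x ∔_) (-‿inverseˡ y) ⟨
    x ∔ (⊖ y ∔ y)    ≡⟨ +-assoc x (⊖ y) y ⟨
    (x ∔ ⊖ y) ∔ y    ≡⟨ cong (_∔ y) e ⟩
    0# ∔ y           ≡⟨ +-identityˡ y ⟩
    y                ∎
    where open ≡-Reasoning

  x≡y∔z⇒x∔⊖y≡z : ∀ {x y z} → x ≡ y ∔ z → x ∔ ⊖ y ≡ z
  x≡y∔z⇒x∔⊖y≡z {x} {y} {z} refl = begin
    y ∔ z ∔ ⊖ y      ≡⟨ cong (_∔ ⊖ y) (+-comm y z) ⟩
    z ∔ y ∔ ⊖ y      ≡⟨ +-assoc z y (⊖ y) ⟩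
    z ∔ (y ∔ ⊖ y)    ≡⟨ cong (z ∔_) (-‿inverseʳ y) ⟩
    z ∔ 0#           ≡⟨ +-identityʳ z ⟩
    z                ∎
    where open ≡-Reasoning

  x∔⊖y≡z⇒x≡y∔z : ∀ {x y z} → x ∔ ⊖ y ≡ z → x ≡ y ∔ z
  x∔⊖y≡z⇒x≡y∔z {x} {y} refl = begin
    x                ≡⟨ +-identityʳ x ⟨
    x ∔ 0#           ≡⟨ cong (x ∔_) (-‿inverseʳ y) ⟨
    x ∔ (y ∔ ⊖ y)    ≡⟨ solve 3 (λ x y z → x :+ (y :+ z) := y :+ (x :+ z)) refl x y (⊖ y) ⟩
    y ∔ (x ∔ ⊖ y)    ∎
    where open ≡-Reasoning

  divide : ∀ {a x y} (a≢0 : a ≢ 0#) → x ≡ a · y → y ≡ proj₁ (inverse a a≢0) · x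
  divide {a} {x} {y} a≢0 refl with inverse a a≢0
  ... | a⁻¹ , aa⁻¹≡1 = begin
    y               ≡⟨ *-identityˡ y ⟨
    1# · y          ≡⟨ cong (_· y) aa⁻¹≡1 ⟨
    a · a⁻¹ · y     ≡⟨ solve 3 (λ x x⁻¹ y → x :* x⁻¹ :* y := x⁻¹ :* (x :* y)) refl a a⁻¹ y ⟩
    a⁻¹ · (a · y)   ∎
    where open ≡-Reasoning

  -- Coordinate vectors over the field: numbering, summation, counting

  enum : ∀ {k} → Fin (q ^ k) → Fin k → F
  enum t = from ∘ Fin.finToFun t

  code : ∀ {k} → (Fin k → F) → Fin (q ^ k)
  code c = Fin.funToFin (to ∘ c)

  enum-code : ∀ {k} (c : Fin k → F) → enum (code c) ≗ c
  enum-code c i = trans (cong from (Fin.finToFun-funToFin (to ∘ c) i)) (from-to (c i))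

  code-injective : ∀ {k} {c c′ : Fin k → F} → code c ≡ code c′ → c ≗ c′
  code-injective {c = c} {c′} e i =
    trans (sym (enum-code c i)) (trans (cong (λ t → enum t i) e) (enum-code c′ i))

  enum-injective : ∀ {k} {t t′ : Fin (q ^ k)} → enum {k} t ≗ enum t′ → t ≡ t′
  enum-injective {k} {t} {t′} e = begin
    t                                              ≡⟨ Fin.funToFin-finToFin {k} {q} t ⟨
    Fin.funToFin {k} (Fin.finToFun {q} {k} t)      ≡⟨ funToFin-cong (from-injective ∘ e) ⟩
    Fin.funToFin {k} (Fin.finToFun {q} {k} t′)     ≡⟨ Fin.funToFin-finToFin {k} {q} t′ ⟩
    t′                                             ∎
    where open ≡-Reasoning

  -- Iterated over coordinates rather than over codes in `Fin (q ^ k)`, so that one coordinate can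
  -- be isolated and summed first.
  sumFun : ∀ k → ((Fin k → F) → ℤ) → ℤ
  sumFun zero    f = f []
  sumFun (suc k) f = sumℤ q (λ t → sumFun k (λ c → f (from t ∷ c)))

  sumFun-cong : ∀ k {f g : (Fin k → F) → ℤ} → f ≗ g → sumFun k f ≡ sumFun k g
  sumFun-cong zero    f≗g = f≗g []
  sumFun-cong (suc k) f≗g = sum-cong q (λ t → sumFun-cong k (λ c → f≗g (from t ∷ c)))

  sumFun-const : ∀ k m → sumFun k (λ _ → + m) ≡ + (q ^ k ℕ.* m)
  sumFun-const zero    m = cong +_ (sym (ℕ.*-identityˡ m))
  sumFun-const (suc k) m = begin
    sumℤ q (λ t → sumFun k (λ _ → + m))   ≡⟨ sum-cong q (λ t → sumFun-const k m) ⟩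
    sumℤ q (λ t → + (q ^ k ℕ.* m))        ≡⟨ sum-const q (q ^ k ℕ.* m) ⟩
    + (q ℕ.* (q ^ k ℕ.* m))               ≡⟨ cong +_ (ℕ.*-assoc q (q ^ k) m) ⟨
    + (q ^ suc k ℕ.* m)                   ∎
    where open ≡-Reasoning

  sumFun-swap : ∀ m k (f : Fin m → (Fin k → F) → ℤ) →
    sumℤ m (λ i → sumFun k (f i)) ≡ sumFun k (λ c → sumℤ m (λ i → f i c))
  sumFun-swap m zero    f = refl
  sumFun-swap m (suc k) f = trans (sum-swap m q _)
    (sum-cong q (λ t → sumFun-swap m k (λ i c → f i (from t ∷ c))))

  sumFun-zero : ∀ k {f : (Fin k → F) → ℤ} → (∀ c → f c ≡ + 0) → sumFun k f ≡ + 0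
  sumFun-zero k {f} f≡0 = trans (sumFun-cong k f≡0)
    (trans (sumFun-const k 0) (cong +_ (ℕ.*-zeroʳ (q ^ k))))

  -- A coordinate with nonzero coefficient is determined by the other `k`, which are free. If it is
  -- not the first one, the first is fixed and its term moved to the left-hand side, whence the
  -- constant `a`. The solution set enters through an indicator `f`, so that incidence with a
  -- varying hyperplane can be substituted.
  count-affine-solutions : ∀ k (x : Fin (suc k) → F) i → x i ≢ 0# → ∀ a (f : (Fin (suc k) → F) → ℤ) →
    (∀ c → IsIndicator (f c) (a ≡ sumF 𝔽 (suc k) (λ l → x l · c l))) →
    sumFun (suc k) f ≡ + (q ^ k)
  count-affine-solutions k x zero x₀≢0 a f f-ind = begin
    sumℤ q (λ t → sumFun k (λ c → f (from t ∷ c)))   ≡⟨ sumFun-swap q k _ ⟩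
    sumFun k (λ c → sumℤ q (λ t → f (from t ∷ c)))   ≡⟨ sumFun-cong k single ⟩
    sumFun k (λ c → + 1)                             ≡⟨ sumFun-const k 1 ⟩
    + (q ^ k ℕ.* 1)                                  ≡⟨ cong +_ (ℕ.*-identityʳ (q ^ k)) ⟩
    + (q ^ k)                                        ∎
    where
    open ≡-Reasoning
    single : ∀ c → sumℤ q (λ t → f (from t ∷ c)) ≡ + 1
    single c = trans (sum-single q (to y) others) (indicator-1 (f-ind _) solution)
      where
      rest = sumF 𝔽 k (λ l → x (suc l) · c l)
      x₀⁻¹ = proj₁ (inverse (x zero) x₀≢0)
      y = x₀⁻¹ · (a ∔ ⊖ rest)

      solution : a ≡ x zero · from (to y) ∔ rest
      solution = begin
        a                                      ≡⟨ x∔⊖y≡z⇒x≡y∔z refl ⟩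
        rest ∔ (a ∔ ⊖ rest)                    ≡⟨ +-comm _ _ ⟩
        a ∔ ⊖ rest ∔ rest                      ≡⟨ cong (_∔ rest) (*-identityˡ _) ⟨
        1# · (a ∔ ⊖ rest) ∔ rest               ≡⟨ cong (λ e → e · (a ∔ ⊖ rest) ∔ rest) (proj₂ (inverse (x zero) x₀≢0)) ⟨
        x zero · x₀⁻¹ · (a ∔ ⊖ rest) ∔ rest    ≡⟨ cong (_∔ rest) (*-assoc _ _ _) ⟩
        x zero · y ∔ rest                      ≡⟨ cong (λ e → x zero · e ∔ rest) (from-to y) ⟨
        x zero · from (to y) ∔ rest            ∎

      others : ∀ t → t ≢ to y → f (from t ∷ c) ≡ + 0
      others t t≢ = indicator-0 (f-ind _) λ e → t≢ (trans (sym (to-from t)) (cong to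
        (divide x₀≢0 (x≡y∔z⇒x∔⊖y≡z (trans e (+-comm _ _))))))
  count-affine-solutions (suc k) x (suc i) xᵢ≢0 a f f-ind = begin
    sumℤ q (λ t → sumFun (suc k) (λ c → f (from t ∷ c)))
      ≡⟨ sum-cong q (λ t → count-affine-solutions k (x ∘ suc) i xᵢ≢0 (a ∔ ⊖ (x zero · from t)) _
           (λ c → indicator-map x≡y∔z⇒x∔⊖y≡z x∔⊖y≡z⇒x≡y∔z (f-ind (from t ∷ c)))) ⟩
    sumℤ q (λ t → + (q ^ k))    ≡⟨ sum-const q (q ^ k) ⟩
    + (q ^ suc k)               ∎
    where open ≡-Reasoning

  -- Spans, independence and hyperplanes in V

  module _ {n : ℕ} where

    private
      Vec : Set
      Vec = V 𝔽 n

      lin : ∀ {r} → (Fin r → F) → (Fin r → Vec) → Vec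
      lin = lincomb 𝔽

    lincomb-cong : ∀ {r} {c c′ : Fin r → F} (b : Fin r → Vec) → c ≗ c′ → lin c b ≗ lin c′ b
    lincomb-cong {r} b c≗c′ k = ΣF.sum-cong r (λ i → cong (_· b i k) (c≗c′ i))

    lincomb-+ : ∀ {r} (c c′ : Fin r → F) (b : Fin r → Vec) k →
                lin (λ i → c i ∔ c′ i) b k ≡ lin c b k ∔ lin c′ b k
    lincomb-+ {r} c c′ b k = trans (ΣF.sum-cong r (λ i → distribʳ (b i k) (c i) (c′ i))) (ΣF.sum-+ r _ _)

    lincomb-scale : ∀ {r} a (c : Fin r → F) (b : Fin r → Vec) k →
                    lin (λ i → a · c i) b k ≡ a · lin c b k
    lincomb-scale {r} a c b k = trans (ΣF.sum-cong r (λ i → *-assoc a (c i) (b i k))) (ΣF.sum-*ˡ r a _)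

    lincomb-0 : ∀ {r} (b : Fin r → Vec) k → lin (λ _ → 0#) b k ≡ 0#
    lincomb-0 {r} b k = ΣF.sum-zero r (λ i → zeroˡ (b i k))

    LinIndep-unique : ∀ {r} {b : Fin r → Vec} → LinIndep 𝔽 b → ∀ c c′ →
                      lin c b ≗ lin c′ b → c ≗ c′
    LinIndep-unique {r} {b} indep c c′ e i =
      x∔⊖y≡0⇒x≡y (c i) (c′ i) (indep (λ i → c i ∔ ⊖ (c′ i)) vanish i)
      where
      open ≡-Reasoning
      vanish : ∀ k → lin (λ i → c i ∔ ⊖ (c′ i)) b k ≡ 0#
      vanish k = begin
        lin (λ i → c i ∔ ⊖ (c′ i)) b k             ≡⟨ lincomb-+ c (λ i → ⊖ (c′ i)) b k ⟩
        lin c b k ∔ lin (λ i → ⊖ (c′ i)) b k       ≡⟨ cong (_∔ lin (λ i → ⊖ (c′ i)) b k) (e k) ⟩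
        lin c′ b k ∔ lin (λ i → ⊖ (c′ i)) b k      ≡⟨ lincomb-+ c′ (λ i → ⊖ (c′ i)) b k ⟨
        lin (λ i → c′ i ∔ ⊖ (c′ i)) b k            ≡⟨ lincomb-cong b (λ i → -‿inverseʳ (c′ i)) k ⟩
        lin (λ _ → 0#) b k                         ≡⟨ lincomb-0 b k ⟩
        0#                                         ∎

    InSpan-scale : ∀ {r} {b : Fin r → Vec} {x y} a → (∀ k → y k ≡ a · x k) →
                   InSpan 𝔽 b x → InSpan 𝔽 b y
    InSpan-scale {b = b} a y≡ax (c , x≡) = (λ i → a · c i) ,
      λ k → trans (y≡ax k) (trans (cong (a ·_) (x≡ k)) (sym (lincomb-scale a c b k)))

    -- Exhaustive search over the q^r coefficient vectors.
    inSpan? : ∀ {r} (b : Fin r → Vec) x → Dec (InSpan 𝔽 b x)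
    inSpan? b x = map′
      (λ (t , e) → enum t , e)
      (λ (c , e) → code c , λ k → trans (e k) (sym (lincomb-cong b (enum-code c) k)))
      (Fin.any? (λ t → Fin.all? (λ k → x k ≟F lin (enum t) b k)))

    -- In a vanishing combination, a nonzero coefficient of `x` could be divided out, putting `x`
    -- into the span.
    LinIndep-∷ : ∀ {r} {b : Fin r → Vec} {x} → LinIndep 𝔽 b → ¬ InSpan 𝔽 b x → LinIndep 𝔽 (x ∷ b)
    LinIndep-∷ {b = b} {x} indep x∉ c e = λ { zero → c₀≡0 ; (suc i) → indep (c ∘ suc) rest≡0 i }
      where
      open ≡-Reasoning
      c₀≡0 : c zero ≡ 0#
      c₀≡0 = decidable-stable (c zero ≟F 0#) λ c₀≢0 → x∉
        (InSpan-scale (proj₁ (inverse (c zero) c₀≢0) · ⊖ 1#) (scaled c₀≢0) (c ∘ suc , λ _ → refl))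
        where
        scaled : ∀ c₀≢0 k → x k ≡ proj₁ (inverse (c zero) c₀≢0) · ⊖ 1# · lin (c ∘ suc) b k
        scaled c₀≢0 k = trans (divide c₀≢0 refl) (trans (cong (_ ·_) neg) (sym (*-assoc _ _ _)))
          where
          neg : c zero · x k ≡ ⊖ 1# · lin (c ∘ suc) b k
          neg = begin
            c zero · x k
              ≡⟨ x∔⊖y≡z⇒x≡y∔z refl ⟩
            lin (c ∘ suc) b k ∔ (c zero · x k ∔ ⊖ lin (c ∘ suc) b k)
              ≡⟨ solve 3 (λ l m y → l :+ (m :+ y) := (m :+ l) :+ y) refl (lin (c ∘ suc) b k) (c zero · x k) (⊖ lin (c ∘ suc) b k) ⟩
            c zero · x k ∔ lin (c ∘ suc) b k ∔ ⊖ lin (c ∘ suc) b k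
              ≡⟨ cong (_∔ ⊖ lin (c ∘ suc) b k) (e k) ⟩
            0# ∔ ⊖ lin (c ∘ suc) b k
              ≡⟨ +-identityˡ _ ⟩
            ⊖ lin (c ∘ suc) b k
              ≡⟨ cong ⊖_ (*-identityˡ _) ⟨
            ⊖ (1# · lin (c ∘ suc) b k)
              ≡⟨ -‿distribˡ-* 1# _ ⟩
            ⊖ 1# · lin (c ∘ suc) b k ∎

      rest≡0 : ∀ k → lin (c ∘ suc) b k ≡ 0#
      rest≡0 k = begin
        lin (c ∘ suc) b k                  ≡⟨ +-identityˡ _ ⟨
        0# ∔ lin (c ∘ suc) b k             ≡⟨ cong (_∔ lin (c ∘ suc) b k) (trans (cong (_· x k) c₀≡0) (zeroˡ _)) ⟨
        c zero · x k ∔ lin (c ∘ suc) b k   ≡⟨ e k ⟩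
        0#                                 ∎

    -- There are only q^r linear combinations of r vectors.
    not-spanning : ∀ {r} → 2 ℕ.≤ q → r ℕ.≤ n → (b : Fin r → Vec) → ∃ λ x → ¬ InSpan 𝔽 b x
    not-spanning {r} 2≤q r≤n b with Fin.all? (λ t → inSpan? b (enum {suc n} t))
    ... | no ¬all = let t , x∉ = Fin.¬∀⟶∃¬ _ _ (λ t → inSpan? b (enum {suc n} t)) ¬all in enum {suc n} t , x∉
    ... | yes all = contradiction (Fin.injective⇒≤ injective) (ℕ.<⇒≱ (ℕ.^-monoʳ-< q 2≤q (ℕ.s≤s r≤n)))
      where
      injective : ∀ {t t′} → code (proj₁ (all t)) ≡ code (proj₁ (all t′)) → t ≡ t′
      injective {t} {t′} e = enum-injective {suc n} (λ k → trans (proj₂ (all t) k)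
        (trans (lincomb-cong b (code-injective e) k) (sym (proj₂ (all t′) k))))

    LinIndep-extend : ∀ {r} → 2 ℕ.≤ q → r ℕ.≤ n → {b : Fin r → Vec} → LinIndep 𝔽 b → ∃ λ x → LinIndep 𝔽 (x ∷ b)
    LinIndep-extend 2≤q r≤n {b} indep with not-spanning 2≤q r≤n b
    ... | x , x∉ = x , LinIndep-∷ indep x∉

    LinIndep-exists : 2 ℕ.≤ q → ∀ r → r ℕ.≤ suc n → Σ (Fin r → Vec) (LinIndep 𝔽)
    LinIndep-exists 2≤q zero    _         = [] , λ _ _ ()
    LinIndep-exists 2≤q (suc r) (ℕ.s≤s r≤n) with LinIndep-exists 2≤q r (ℕ.m≤n⇒m≤1+n r≤n)
    ... | b , indep with LinIndep-extend 2≤q r≤n indep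
    ... | x , indep′ = x ∷ b , indep′

    lincomb-swap : ∀ {r} c (x y : Vec) (w : Fin r → Vec) k →
      lin c (y ∷ x ∷ w) k ≡ lin (c (suc zero) ∷ c zero ∷ (λ i → c (suc (suc i)))) (x ∷ y ∷ w) k
    lincomb-swap c x y w k =
      solve 3 (λ a b l → a :+ (b :+ l) := b :+ (a :+ l)) refl
        (c zero · y k) (c (suc zero) · x k) (lin (λ i → c (suc (suc i))) w k)

    LinIndep-swap : ∀ {r} {x y} {w : Fin r → Vec} → LinIndep 𝔽 (x ∷ y ∷ w) → LinIndep 𝔽 (y ∷ x ∷ w)
    LinIndep-swap {x = x} {y} {w} indep c e =
      λ { zero → indep′ (suc zero) ; (suc zero) → indep′ zero ; (suc (suc i)) → indep′ (suc (suc i)) }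
      where
      indep′ = indep (c (suc zero) ∷ c zero ∷ (λ i → c (suc (suc i))))
        (λ k → trans (sym (lincomb-swap c x y w k)) (e k))

    InSpan-swap : ∀ {r} {x y} {w : Fin r → Vec} {u} → InSpan 𝔽 (y ∷ x ∷ w) u → InSpan 𝔽 (x ∷ y ∷ w) u
    InSpan-swap {x = x} {y} {w} (c , e) = c (suc zero) ∷ c zero ∷ (λ i → c (suc (suc i))) ,
      λ k → trans (e k) (lincomb-swap c x y w k)

    LinIndep-rotate : ∀ {r} {x y z} {w : Fin r → Vec} →
                      LinIndep 𝔽 (x ∷ y ∷ z ∷ w) → LinIndep 𝔽 (y ∷ z ∷ x ∷ w)
    LinIndep-rotate {x = x} {y} {z} {w} indep c e =
      λ { zero → indep′ (suc zero) ; (suc zero) → indep′ (suc (suc zero))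
        ; (suc (suc zero)) → indep′ zero ; (suc (suc (suc i))) → indep′ (suc (suc (suc i))) }
      where
      c′ = c (suc (suc zero)) ∷ c zero ∷ c (suc zero) ∷ (λ i → c (suc (suc (suc i))))
      indep′ = indep c′ (λ k → trans
        (solve 4 (λ a b d l → d :+ (a :+ (b :+ l)) := a :+ (b :+ (d :+ l))) refl
          (c zero · y k) (c (suc zero) · z k) (c (suc (suc zero)) · x k) (lin (λ i → c (suc (suc (suc i)))) w k))
        (e k))

    -- Extension puts the new vector in front. Rotating it behind the pair keeps `x` in the leading
    -- position, the one that `hyperplane` singles out.
    LinIndep-complete-pair : ∀ {x y : Vec} → 2 ℕ.≤ q → ∀ m → suc m ℕ.≤ n → LinIndep 𝔽 (x ∷ y ∷ []) →
                             ∃ λ (w : Fin m → Vec) → LinIndep 𝔽 (x ∷ y ∷ w)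
    LinIndep-complete-pair 2≤q zero    _   indep = [] , indep
    LinIndep-complete-pair {x} {y} 2≤q (suc m) m<n indep
      with LinIndep-complete-pair {x} {y} 2≤q m (ℕ.<⇒≤ m<n) indep
    ... | w , indep′ with LinIndep-extend 2≤q m<n {x ∷ y ∷ w} indep′
    ... | u , indep″ = u ∷ w , LinIndep-rotate {x = u} {x} {y} {w} indep″

    -- As c varies, the spans of (hyperplane b c) are the hyperplanes of span b
    -- that do not contain b zero.
    hyperplane : ∀ {k} → (Fin (suc k) → Vec) → (Fin k → F) → Fin k → Vec
    hyperplane b c i t = b (suc i) t ∔ c i · b zero t

    module _ {k : ℕ} (b : Fin (suc k) → Vec) (c : Fin k → F) where

      lincomb-hyperplane : ∀ (y : Fin k → F) →
        lin y (hyperplane b c) ≗ lin (sumF 𝔽 k (λ i → y i · c i) ∷ y) b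
      lincomb-hyperplane y t = begin
        sumF 𝔽 k (λ i → y i · (b (suc i) t ∔ c i · b zero t))
          ≡⟨ ΣF.sum-cong k (λ i → solve 4 (λ y w c z → y :* (w :+ c :* z) := y :* c :* z :+ y :* w) refl (y i) (b (suc i) t) (c i) (b zero t)) ⟩
        sumF 𝔽 k (λ i → y i · c i · b zero t ∔ y i · b (suc i) t)
          ≡⟨ ΣF.sum-+ k _ _ ⟩
        sumF 𝔽 k (λ i → y i · c i · b zero t) ∔ sumF 𝔽 k (λ i → y i · b (suc i) t)
          ≡⟨ cong (_∔ sumF 𝔽 k (λ i → y i · b (suc i) t)) (ΣF.sum-*ʳ k (b zero t) _) ⟩
        sumF 𝔽 k (λ i → y i · c i) · b zero t ∔ sumF 𝔽 k (λ i → y i · b (suc i) t) ∎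
        where open ≡-Reasoning

      LinIndep-hyperplane : LinIndep 𝔽 b → LinIndep 𝔽 (hyperplane b c)
      LinIndep-hyperplane indep y e i =
        indep (sumF 𝔽 k (λ i → y i · c i) ∷ y) (λ t → trans (sym (lincomb-hyperplane y t)) (e t)) (suc i)

      InSpan-hyperplane⇒InSpan : ∀ {x} → InSpan 𝔽 (hyperplane b c) x → InSpan 𝔽 b x
      InSpan-hyperplane⇒InSpan (y , e) =
        sumF 𝔽 k (λ i → y i · c i) ∷ y , λ t → trans (e t) (lincomb-hyperplane y t)

      module _ {x : Vec} (a : Fin (suc k) → F) (x≡ : ∀ t → x t ≡ lin a b t) where

        InSpan-hyperplane : a zero ≡ sumF 𝔽 k (λ i → a (suc i) · c i) → InSpan 𝔽 (hyperplane b c) x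
        InSpan-hyperplane e = a ∘ suc , λ t → trans (x≡ t)
          (trans (lincomb-cong {c = a} {sumF 𝔽 k (λ i → a (suc i) · c i) ∷ a ∘ suc} b
            (λ { zero → e ; (suc i) → refl }) t) (sym (lincomb-hyperplane (a ∘ suc) t)))

        InSpan-hyperplane⁻¹ : LinIndep 𝔽 b → InSpan 𝔽 (hyperplane b c) x →
                              a zero ≡ sumF 𝔽 k (λ i → a (suc i) · c i)
        InSpan-hyperplane⁻¹ indep (y , e) = trans (unique zero)
          (ΣF.sum-cong k (λ i → cong (_· c i) (sym (unique (suc i)))))
          where
          unique = LinIndep-unique {b = b} indep a (sumF 𝔽 k (λ i → y i · c i) ∷ y)
            (λ t → trans (sym (x≡ t)) (trans (e t) (lincomb-hyperplane y t)))

-- Points and incidences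

-- 1 + q + ... + q^(k-1) in Horner form: the Gaussian number without subtraction or division, in the
-- recursion that `count-points` produces.
geometricSum : ℕ → ℕ → ℕ
geometricSum q zero    = 0
geometricSum q (suc k) = suc (q ℕ.* geometricSum q k)

geometricSum-closed : ∀ q k → geometricSum (suc q) k ℕ.* q ≡ suc q ^ k ℕ.∸ 1
geometricSum-closed q k = trans (sym (ℕ.m+n∸n≡m _ 1)) (cong (ℕ._∸ 1) (closed k))
  where
  open ≡-Reasoning
  identity : ∀ q G → (ℕ.suc (q ℕ.* G ℕ.+ G)) ℕ.* q ℕ.+ 1 ≡ (1 ℕ.+ q) ℕ.* (G ℕ.* q ℕ.+ 1)
  identity = ℕ-solve-∀
  closed : ∀ k → geometricSum (suc q) k ℕ.* q ℕ.+ 1 ≡ suc q ^ k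
  closed zero    = refl
  closed (suc k) = begin
    suc (suc q ℕ.* G) ℕ.* q ℕ.+ 1       ≡⟨ cong (λ e → suc e ℕ.* q ℕ.+ 1) (ℕ.+-comm G (q ℕ.* G)) ⟩
    suc (q ℕ.* G ℕ.+ G) ℕ.* q ℕ.+ 1     ≡⟨ identity q G ⟩
    suc q ℕ.* (G ℕ.* q ℕ.+ 1)           ≡⟨ cong (suc q ℕ.*_) (closed k) ⟩
    suc q ^ suc k                       ∎
    where G = geometricSum (suc q) k

gauss≡geometricSum : ∀ {q} → 2 ℕ.≤ q → ∀ r → gauss q r ≡ geometricSum q r
gauss≡geometricSum {suc (suc q)} _ r = trans
  (cong (ℕ._/ suc q) (sym (geometricSum-closed (suc q) r)))
  (m*n/n≡m (geometricSum (suc (suc q)) r) (suc q))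
gauss≡geometricSum {suc zero} (ℕ.s≤s ())

module Points {q : ℕ} (𝔽 : FiniteField q) (2≤q : 2 ℕ.≤ q) {n v : ℕ}
              {Z : Fin v → Subset 𝔽 n} (EZ : Enumerates 𝔽 n 1 v Z) where

  open LinearAlgebra 𝔽 public
  open Enumerates EZ

  private
    Vec : Set
    Vec = V 𝔽 n

    infix 4 _∈_
    _∈_ : ∀ {r} → Vec → (Fin r → Vec) → Set
    x ∈ b = InSpan 𝔽 b x

  gen : Fin v → Vec
  gen j = proj₁ (isSub j) zero

  ∈Z⇒scalar : ∀ {j x} → Z j x → ∃ λ a → ∀ k → x k ≡ a · gen j k
  ∈Z⇒scalar {j} {x} x∈Z with proj₁ (proj₂ (proj₂ (isSub j)) x) x∈Z
  ... | c , e = c zero , λ k → trans (e k) (+-identityʳ _)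

  scalar⇒∈Z : ∀ {j x} a → (∀ k → x k ≡ a · gen j k) → Z j x
  scalar⇒∈Z {j} {x} a e = proj₂ (proj₂ (proj₂ (isSub j)) x) ((λ _ → a) , λ k → trans (e k) (sym (+-identityʳ _)))

  gen≢0 : ∀ j → ¬ (∀ k → gen j k ≡ 0#)
  gen≢0 j e = 0≢1 (sym (proj₁ (proj₂ (isSub j)) (λ _ → 1#)
    (λ k → trans (+-identityʳ _) (trans (*-identityˡ _) (e k))) zero))

  coefficient≢0 : ∀ {j} {z : Vec} {a} → (∀ k → gen j k ≡ a · z k) → a ≢ 0#
  coefficient≢0 {j} {z} e refl = gen≢0 j (λ k → trans (e k) (zeroˡ (z k)))

  ⊆span⇒gen∈ : ∀ {r} {b : Fin r → Vec} {j} → _⊆_ 𝔽 (Z j) (InSpan 𝔽 b) → gen j ∈ b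
  ⊆span⇒gen∈ {j = j} Z⊆ = Z⊆ (gen j) (scalar⇒∈Z 1# (λ k → sym (*-identityˡ _)))

  gen∈⇒⊆span : ∀ {r} {b : Fin r → Vec} {j} → gen j ∈ b → _⊆_ 𝔽 (Z j) (InSpan 𝔽 b)
  gen∈⇒⊆span {b = b} g∈ x x∈Z with ∈Z⇒scalar x∈Z
  ... | a , e = InSpan-scale {b = b} a e g∈

  -- Since `gen j′` is nonzero, so is `a′`; dividing by it expresses z, and with it all of Z j,
  -- through `gen j′`.
  proportional⇒⊆ : ∀ {j j′} {z : Vec} {a a′} → (∀ k → gen j k ≡ a · z k) → (∀ k → gen j′ k ≡ a′ · z k) →
                   _⊆_ 𝔽 (Z j) (Z j′)
  proportional⇒⊆ {j} {j′} {z} {a} {a′} e e′ x x∈Z with ∈Z⇒scalar x∈Z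
  ... | c , x≡ = scalar⇒∈Z (c · a · a′⁻¹) λ k → begin
    x k                         ≡⟨ x≡ k ⟩
    c · gen j k                 ≡⟨ cong (c ·_) (e k) ⟩
    c · (a · z k)               ≡⟨ cong (λ y → c · (a · y)) (divide a′≢0 (e′ k)) ⟩
    c · (a · (a′⁻¹ · gen j′ k)) ≡⟨ solve 4 (λ c a i g → c :* (a :* (i :* g)) := c :* a :* i :* g) refl c a a′⁻¹ (gen j′ k) ⟩
    c · a · a′⁻¹ · gen j′ k     ∎
    where
    open ≡-Reasoning
    a′≢0 = coefficient≢0 {z = z} e′
    a′⁻¹ = proj₁ (inverse a′ a′≢0)

  proportional⇒≡ : ∀ {j j′} {z : Vec} {a a′} → (∀ k → gen j k ≡ a · z k) → (∀ k → gen j′ k ≡ a′ · z k) → j ≡ j′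
  proportional⇒≡ {j} {j′} {z} e e′ =
    distinct j j′ (proportional⇒⊆ {z = z} e e′ , proportional⇒⊆ {z = z} e′ e)

  point-of : ∀ (b : Fin 1 → Vec) → LinIndep 𝔽 b → ∃ λ j → gen j ∈ b
  point-of b indep with complete (InSpan 𝔽 b) (b , indep , λ x → (λ p → p) , λ p → p)
  ... | j , _ , Z⊆ = j , ⊆span⇒gen∈ {b = b} Z⊆

  χ : ∀ {r} → (Fin r → Vec) → Fin v → ℤ
  χ b j = indicator (inSpan? b (gen j))

  χ-correct : ∀ {r} (b : Fin r → Vec) j → IsIndicator (χ b j) (gen j ∈ b)
  χ-correct b j = indicator-correct (inSpan? b (gen j))

  -- `b` spans a subspace of dimension k + 2 whose first vector lies on the line of the point `j₀`.
  -- The hyperplanes have dimension k + 1 and are indexed by F^(k+1).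
  module HyperplaneSum {k} (b : Fin (suc (suc k)) → Vec) (indep : LinIndep 𝔽 b)
                 {j₀ a₀} (point : ∀ t → gen j₀ t ≡ a₀ · b zero t) where

    private
      H = hyperplane b

      a₀∷0 : Fin (suc (suc k)) → F
      a₀∷0 = a₀ ∷ λ _ → 0#

      gen-j₀ : ∀ t → gen j₀ t ≡ lincomb 𝔽 a₀∷0 b t
      gen-j₀ t = trans (point t) (trans (sym (+-identityʳ _))
        (cong (a₀ · b zero t ∔_) (sym (lincomb-0 (b ∘ suc) t))))

      Goal : Fin v → Set
      Goal j = sumFun (suc k) (λ c → χ (H c) j) ≡ + (q ^ k) ℤ.* (χ b j ℤ.- idM j₀ j)

      outside : ∀ j → ¬ gen j ∈ b → Goal j
      outside j g∉ = trans
        (sumFun-zero (suc k) (λ c → indicator-0 (χ-correct (H c) j) (g∉ ∘ InSpan-hyperplane⇒InSpan b c)))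
        (sym (trans (cong₂ (λ x y → + (q ^ k) ℤ.* (x ℤ.- y))
                           (indicator-0 (χ-correct b j) g∉) (idM-off j₀≢j))
                    (ℤ.*-zeroʳ (+ (q ^ k)))))
        where
        j₀≢j : j₀ ≢ j
        j₀≢j refl = g∉ (a₀∷0 , gen-j₀)

      -- Some coefficient of the equation for `c` is nonzero, so it has q^k solutions. Uniqueness of
      -- coordinates separates the point from `j₀`.
      generic : ∀ j a → (∀ t → gen j t ≡ lincomb 𝔽 a b t) → ∀ i → a (suc i) ≢ 0# → Goal j
      generic j a e i aᵢ≢0 = trans
        (count-affine-solutions k (a ∘ suc) i aᵢ≢0 (a zero) (λ c → χ (H c) j) (λ c → indicator-map
          (InSpan-hyperplane⁻¹ b c a e indep) (InSpan-hyperplane b c a e) (χ-correct (H c) j)))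
        (sym (trans (cong₂ (λ x y → + (q ^ k) ℤ.* (x ℤ.- y))
                           (indicator-1 (χ-correct b j) (a , e)) (idM-off j₀≢j))
                    (ℤ.*-identityʳ (+ (q ^ k)))))
        where
        j₀≢j : j₀ ≢ j
        j₀≢j refl = aᵢ≢0 (LinIndep-unique {b = b} indep a a₀∷0 (λ t → trans (sym (e t)) (gen-j₀ t)) (suc i))

      -- All coefficients of the equation for `c` vanish and it reads a₀ = 0, which fails because a
      -- generator is nonzero.
      vertex : ∀ j a → (∀ t → gen j t ≡ lincomb 𝔽 a b t) → (∀ i → a (suc i) ≡ 0#) → Goal j
      vertex j a e a≡0 = trans
        (sumFun-zero (suc k) (λ c → indicator-0 (χ-correct (H c) j) (avoids c)))
        (sym (trans (cong₂ (λ x y → + (q ^ k) ℤ.* (x ℤ.- y))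
                           (indicator-1 (χ-correct b j) (a , e))
                           (trans (cong (λ i → idM i j) (sym (proportional⇒≡ {z = b zero} gen-j point))) (idM-diag j)))
                    (ℤ.*-zeroʳ (+ (q ^ k)))))
        where
        gen-j : ∀ t → gen j t ≡ a zero · b zero t
        gen-j t = trans (e t) (trans
          (cong (a zero · b zero t ∔_) (ΣF.sum-zero (suc k) (λ i → trans (cong (_· b (suc i) t) (a≡0 i)) (zeroˡ _))))
          (+-identityʳ _))

        avoids : ∀ c → ¬ gen j ∈ H c
        avoids c g∈ = coefficient≢0 {z = b zero} gen-j (trans (InSpan-hyperplane⁻¹ b c a e indep g∈)
          (ΣF.sum-zero (suc k) (λ i → trans (cong (_· c i) (a≡0 i)) (zeroˡ _))))

    χ-sum : ∀ j → sumFun (suc k) (λ c → χ (H c) j) ≡ + (q ^ k) ℤ.* (χ b j ℤ.- idM j₀ j)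
    χ-sum j = cases (inSpan? b (gen j))
      where
      cases : Dec (gen j ∈ b) → Goal j
      cases (no g∉)       = outside j g∉
      cases (yes (a , e)) with Fin.any? (λ i → ¬? (a (suc i) ≟F 0#))
      ... | yes (i , aᵢ≢0) = generic j a e i aᵢ≢0
      ... | no  a≡0        = vertex j a e (λ i → decidable-stable (a (suc i) ≟F 0#) (λ x → a≡0 (i , x)))

  first-point : ∀ {k} (b : Fin (suc k) → Vec) → LinIndep 𝔽 b →
                ∃₂ λ j a → ∀ t → gen j t ≡ a · b zero t
  first-point b indep with point-of (λ _ → b zero) indep₀
    where
    indep₀ : LinIndep 𝔽 {n} {1} (λ _ → b zero)
    indep₀ c e zero = indep (c zero ∷ λ _ → 0#)
      (λ t → trans (cong (c zero · b zero t ∔_) (lincomb-0 (b ∘ suc) t)) (e t)) zero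
  ... | j , c , e = j , c zero , λ t → trans (e t) (+-identityʳ _)

  -- Each of the q^(k+1) hyperplanes avoiding `j₀` has `G` points by induction, and each other point
  -- lies on q^k of them. So q^(k+1) G = q^k (total - 1), and cancelling q^k gives the Horner step.
  count-points : ∀ k (b : Fin (suc k) → Vec) → LinIndep 𝔽 b →
                 sumℤ v (χ b) ≡ + geometricSum q (suc k)
  count-points zero b indep with first-point b indep
  ... | j₀ , a₀ , point = begin
    sumℤ v (χ b)                 ≡⟨ sum-single v j₀ others ⟩
    χ b j₀                       ≡⟨ indicator-1 (χ-correct b j₀) ((λ _ → a₀) , λ t → trans (point t) (sym (+-identityʳ _))) ⟩
    + 1                          ≡⟨ cong (λ e → + suc e) (ℕ.*-zeroʳ q) ⟨
    + geometricSum q 1           ∎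
    where
    open ≡-Reasoning
    others : ∀ j → j ≢ j₀ → χ b j ≡ + 0
    others j j≢j₀ = indicator-0 (χ-correct b j) λ (c , e) →
      j≢j₀ (proportional⇒≡ {z = b zero} (λ t → trans (e t) (+-identityʳ _)) point)
  count-points (suc k) b indep with first-point b indep
  ... | j₀ , a₀ , point = begin
    sumℤ v (χ b)                            ≡⟨ add-back (sumℤ v (χ b)) ⟩
    sumℤ v (χ b) ℤ.- + 1 ℤ.+ + 1            ≡⟨ cong (ℤ._+ + 1) cancelled ⟩
    + (q ℕ.* G) ℤ.+ + 1                     ≡⟨ cong +_ (ℕ.+-comm (q ℕ.* G) 1) ⟩
    + geometricSum q (suc (suc k))          ∎
    where
    open ≡-Reasoning
    open HyperplaneSum b indep point
    G = geometricSum q (suc k)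

    instance
      q^k≢0 : ℤ.NonZero (+ (q ^ k))
      q^k≢0 = ℕ.m^n≢0 q k {{ℕ.>-nonZero (ℕ.<⇒≤ 2≤q)}}

    add-back : ∀ x → x ≡ x ℤ.- + 1 ℤ.+ + 1
    add-back = solve-∀

    minus : ∀ x y → x ℤ.- y ≡ x ℤ.+ ℤ.- + 1 ℤ.* y
    minus = solve-∀

    negate : ∀ x → x ℤ.- + 1 ≡ x ℤ.+ ℤ.- + 1 ℤ.* + 1
    negate = solve-∀

    sum-idM : sumℤ v (idM j₀) ≡ + 1
    sum-idM = trans (sum-single v j₀ (λ i i≢j₀ → idM-off (i≢j₀ ∘ sym))) (idM-diag j₀)

    sum-minus : sumℤ v (λ j → χ b j ℤ.- idM j₀ j) ≡ sumℤ v (χ b) ℤ.- + 1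
    sum-minus = begin
      sumℤ v (λ j → χ b j ℤ.- idM j₀ j)               ≡⟨ sum-cong v (λ j → minus (χ b j) (idM j₀ j)) ⟩
      sumℤ v (λ j → χ b j ℤ.+ ℤ.- + 1 ℤ.* idM j₀ j)   ≡⟨ sum-+ v _ _ ⟩
      sumℤ v (χ b) ℤ.+ sumℤ v (λ j → ℤ.- + 1 ℤ.* idM j₀ j)
        ≡⟨ cong (λ e → sumℤ v (χ b) ℤ.+ e) (trans (sum-*ˡ v (ℤ.- + 1) (idM j₀)) (cong (λ e → ℤ.- + 1 ℤ.* e) sum-idM)) ⟩
      sumℤ v (χ b) ℤ.+ ℤ.- + 1 ℤ.* + 1                ≡⟨ negate (sumℤ v (χ b)) ⟨
      sumℤ v (χ b) ℤ.- + 1                            ∎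

    -- Double counting of the pairs (hyperplane of span b missing j₀, point on it).
    cancelled : sumℤ v (χ b) ℤ.- + 1 ≡ + (q ℕ.* G)
    cancelled = ℤ.*-cancelˡ-≡ (+ (q ^ k)) _ _ (begin
      + (q ^ k) ℤ.* (sumℤ v (χ b) ℤ.- + 1)
        ≡⟨ cong (λ e → + (q ^ k) ℤ.* e) sum-minus ⟨
      + (q ^ k) ℤ.* sumℤ v (λ j → χ b j ℤ.- idM j₀ j)
        ≡⟨ sum-*ˡ v (+ (q ^ k)) _ ⟨
      sumℤ v (λ j → + (q ^ k) ℤ.* (χ b j ℤ.- idM j₀ j))
        ≡⟨ sum-cong v (λ j → sym (χ-sum j)) ⟩
      sumℤ v (λ j → sumFun (suc k) (λ c → χ (hyperplane b c) j))
        ≡⟨ sumFun-swap v (suc k) (λ j c → χ (hyperplane b c) j) ⟩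
      sumFun (suc k) (λ c → sumℤ v (χ (hyperplane b c)))
        ≡⟨ sumFun-cong (suc k) (λ c → count-points k (hyperplane b c) (LinIndep-hyperplane b c indep)) ⟩
      sumFun (suc k) (λ _ → + G)
        ≡⟨ sumFun-const (suc k) G ⟩
      + (q ℕ.* q ^ k ℕ.* G)
        ≡⟨ cong +_ (trans (cong (ℕ._* G) (ℕ.*-comm q (q ^ k))) (ℕ.*-assoc (q ^ k) q G)) ⟩
      + (q ^ k ℕ.* (q ℕ.* G))
        ≡⟨ ℤ.pos-* (q ^ k) (q ℕ.* G) ⟩
      + (q ^ k) ℤ.* + (q ℕ.* G) ∎)

-- The row lattice of the incidence matrix

module _ {N v : ℕ} {A : Mat N v} where

  RowLattice-resp : ∀ {x x′} → x ≗ x′ → RowLattice A x → RowLattice A x′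
  RowLattice-resp x≗x′ (y , e) = y , λ j → trans (sym (x≗x′ j)) (e j)

  RowLattice-row : ∀ i → RowLattice A (A i)
  RowLattice-row i = idM i , λ j → sym (sum-idMˡ i (λ k → A k j))

  RowLattice-+ : ∀ {x x′} → RowLattice A x → RowLattice A x′ → RowLattice A (λ j → x j ℤ.+ x′ j)
  RowLattice-+ {x} {x′} (y , e) (y′ , e′) = (λ i → y i ℤ.+ y′ i) , λ j → begin
    x j ℤ.+ x′ j                                   ≡⟨ cong₂ ℤ._+_ (e j) (e′ j) ⟩
    (y ◁ A) j ℤ.+ (y′ ◁ A) j                       ≡⟨ sum-+ N _ _ ⟨
    sumℤ N (λ i → y i ℤ.* A i j ℤ.+ y′ i ℤ.* A i j) ≡⟨ sum-cong N (λ i → sym (ℤ.*-distribʳ-+ (A i j) (y i) (y′ i))) ⟩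
    ((λ i → y i ℤ.+ y′ i) ◁ A) j                   ∎
    where open ≡-Reasoning

  RowLattice-* : ∀ c {x} → RowLattice A x → RowLattice A (λ j → c ℤ.* x j)
  RowLattice-* c {x} (y , e) = (λ i → c ℤ.* y i) , λ j → begin
    c ℤ.* x j                              ≡⟨ cong (c ℤ.*_) (e j) ⟩
    c ℤ.* (y ◁ A) j                        ≡⟨ sum-*ˡ N c _ ⟨
    sumℤ N (λ i → c ℤ.* (y i ℤ.* A i j))   ≡⟨ sum-cong N (λ i → sym (ℤ.*-assoc c (y i) (A i j))) ⟩
    ((λ i → c ℤ.* y i) ◁ A) j              ∎
    where open ≡-Reasoning

  RowLattice-sum : ∀ m {x : Fin m → Fin v → ℤ} → (∀ i → RowLattice A (x i)) →
                   RowLattice A (λ j → sumℤ m (λ i → x i j))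
  RowLattice-sum zero    x∈ = (λ _ → + 0) , λ j → sym (sum-zero N (λ i → ℤ.*-zeroˡ (A i j)))
  RowLattice-sum (suc m) x∈ = RowLattice-+ (x∈ zero) (RowLattice-sum m (x∈ ∘ suc))

module Incidence {q : ℕ} (𝔽 : FiniteField q) (2≤q : 2 ℕ.≤ q) {n r : ℕ} (r<n : suc r ℕ.≤ n)
  {N} {Y : Fin N → Subset 𝔽 n} (EY : Enumerates 𝔽 n (suc r) N Y)
  {v} {Z : Fin v → Subset 𝔽 n} (EZ : Enumerates 𝔽 n 1 v Z)
  {A : Mat N v} (incidence : IsIncidence 𝔽 Y Z A) where

  open Points 𝔽 2≤q EZ
  module EY = Enumerates EY
  module EZ = Enumerates EZ

  -- The subspaces `Y i` have dimension `suc r` here, so the exponent in `s` is that dimension minus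
  -- one.
  s g : ℕ
  s = q ^ r
  g = geometricSum q (suc r)

  A≡χ : ∀ i {b : Fin (suc r) → V 𝔽 n} → SameSub 𝔽 (InSpan 𝔽 b) (Y i) → ∀ j → A i j ≡ χ b j
  A≡χ i {b} (b⊆Y , Y⊆b) j = indicator-unique
    (λ Z⊆Y → ⊆span⇒gen∈ {b = b} (λ x → Y⊆b x ∘ Z⊆Y x))
    (λ g∈ x → b⊆Y x ∘ gen∈⇒⊆span {b = b} g∈ x)
    (incidence i j) (χ-correct b j)

  -- Completeness of the enumeration makes every subspace of the right dimension a row of `A`.
  χ∈lattice : ∀ (b : Fin (suc r) → V 𝔽 n) → LinIndep 𝔽 b → RowLattice A (χ b)
  χ∈lattice b indep with EY.complete (InSpan 𝔽 b) (b , indep , λ x → (λ p → p) , λ p → p)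
  ... | i , same = RowLattice-resp (A≡χ i {b} same) (RowLattice-row i)

  row-sum : ∀ i → sumℤ v (A i) ≡ + g
  row-sum i with EY.isSub i
  ... | b , indep , span = trans
    (sum-cong v (A≡χ i {b} ((λ x → proj₂ (span x)) , (λ x → proj₁ (span x)))))
    (count-points r b indep)

  sumFun∈lattice : ∀ k {f : (Fin k → F) → Fin v → ℤ} → (∀ c → RowLattice A (f c)) →
                   RowLattice A (λ j → sumFun k (λ c → f c j))
  sumFun∈lattice zero    f∈ = f∈ []
  sumFun∈lattice (suc k) f∈ = RowLattice-sum q (λ t → sumFun∈lattice k (λ c → f∈ (from t ∷ c)))

  -- The hyperplanes summed in `χ-sum` have dimension `suc r`, so each contributes a row of `A`.
  flag∈lattice : ∀ (b : Fin (suc (suc r)) → V 𝔽 n) → LinIndep 𝔽 b →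
                 ∀ {j} → (∀ t → b zero t ≡ gen j t) → RowLattice A (λ l → + s ℤ.* (χ b l ℤ.- idM j l))
  flag∈lattice b indep {j} point = RowLattice-resp
    (HyperplaneSum.χ-sum b indep {j} {1#} (λ t → trans (sym (point t)) (sym (*-identityˡ _))))
    (sumFun∈lattice (suc r) (λ c → χ∈lattice (hyperplane b c) (LinIndep-hyperplane b c indep)))

  LinIndep-points : ∀ {j j′} → j ≢ j′ → LinIndep 𝔽 (gen j ∷ gen j′ ∷ [])
  LinIndep-points {j} {j′} j≢j′ = LinIndep-∷ {b = proj₁ (EZ.isSub j′)} (proj₁ (proj₂ (EZ.isSub j′)))
    λ (c , e) → j≢j′ (proportional⇒≡ {z = gen j′}
      (λ t → trans (e t) (+-identityʳ _)) (λ t → sym (*-identityˡ _)))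

  -- Two bases of one subspace, each led by one of the points, give s(χ - e_j′) and s(χ - e_j), and
  -- χ cancels. The subspace has dimension r + 2, which fits into n + 1 by `r<n`.
  difference∈lattice : ∀ j j′ → RowLattice A (λ l → + s ℤ.* (idM j l ℤ.- idM j′ l))
  difference∈lattice j j′ with j Fin.≟ j′
  -- For equal points the vector is zero, obtained as an empty sum.
  ... | yes refl = RowLattice-resp (λ l → sym (zero-diff (+ s) (idM j l))) (RowLattice-sum 0 {λ ()} (λ ()))
    where
    zero-diff : ∀ s x → s ℤ.* (x ℤ.- x) ≡ + 0
    zero-diff = solve-∀
  ... | no j≢j′ with LinIndep-complete-pair 2≤q r r<n (LinIndep-points j≢j′)
  ... | w , indep = RowLattice-resp eq (RowLattice-+
      (flag∈lattice b′ (LinIndep-swap {w = w} indep) (λ _ → refl))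
      (RowLattice-* (ℤ.- + 1) (flag∈lattice b indep (λ _ → refl))))
    where
    b  = gen j ∷ gen j′ ∷ w
    b′ = gen j′ ∷ gen j ∷ w

    χ-swap : ∀ l → χ b′ l ≡ χ b l
    χ-swap l = indicator-unique (InSpan-swap {w = w}) (InSpan-swap {w = w}) (χ-correct b′ l) (χ-correct b l)

    identity : ∀ s x y z → s ℤ.* (x ℤ.- y) ℤ.+ ℤ.- + 1 ℤ.* (s ℤ.* (x ℤ.- z)) ≡ s ℤ.* (z ℤ.- y)
    identity = solve-∀

    eq : ∀ l → + s ℤ.* (χ b′ l ℤ.- idM j′ l) ℤ.+ ℤ.- + 1 ℤ.* (+ s ℤ.* (χ b l ℤ.- idM j l)) ≡
               + s ℤ.* (idM j l ℤ.- idM j′ l)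
    eq l = trans
      (cong (λ x → + s ℤ.* (x ℤ.- idM j′ l) ℤ.+ ℤ.- + 1 ℤ.* (+ s ℤ.* (χ b l ℤ.- idM j l))) (χ-swap l))
      (identity (+ s) (χ b l) (idM j′ l) (idM j l))

  -- When the coordinates sum to zero, x = Σ xⱼ(eⱼ - e_j₀) for any base point `j₀`.
  sum≡0⇒∈lattice : Fin v → ∀ x → sumℤ v x ≡ + 0 → RowLattice A (λ l → + s ℤ.* x l)
  sum≡0⇒∈lattice j₀ x Σx≡0 = RowLattice-resp eq
    (RowLattice-sum v (λ j → RowLattice-* (x j) (difference∈lattice j j₀)))
    where
    open ≡-Reasoning
    expand : ∀ x s a b → x ℤ.* (s ℤ.* (a ℤ.- b)) ≡ s ℤ.* (x ℤ.* a) ℤ.+ ℤ.- (s ℤ.* b) ℤ.* x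
    expand = solve-∀
    collapse : ∀ a b → a ℤ.+ b ℤ.* + 0 ≡ a
    collapse = solve-∀

    eq : ∀ l → sumℤ v (λ j → x j ℤ.* (+ s ℤ.* (idM j l ℤ.- idM j₀ l))) ≡ + s ℤ.* x l
    eq l = begin
      sumℤ v (λ j → x j ℤ.* (+ s ℤ.* (idM j l ℤ.- idM j₀ l)))
        ≡⟨ sum-cong v (λ j → expand (x j) (+ s) (idM j l) (idM j₀ l)) ⟩
      sumℤ v (λ j → + s ℤ.* (x j ℤ.* idM j l) ℤ.+ ℤ.- (+ s ℤ.* idM j₀ l) ℤ.* x j)
        ≡⟨ sum-+ v _ _ ⟩
      sumℤ v (λ j → + s ℤ.* (x j ℤ.* idM j l)) ℤ.+ sumℤ v (λ j → ℤ.- (+ s ℤ.* idM j₀ l) ℤ.* x j)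
        ≡⟨ cong₂ ℤ._+_ (trans (sum-*ˡ v (+ s) _) (cong (λ e → + s ℤ.* e) (sum-idMʳ l x)))
                       (trans (sum-*ˡ v (ℤ.- (+ s ℤ.* idM j₀ l)) x) (cong (λ e → ℤ.- (+ s ℤ.* idM j₀ l) ℤ.* e) Σx≡0)) ⟩
      + s ℤ.* x l ℤ.+ ℤ.- (+ s ℤ.* idM j₀ l) ℤ.* + 0
        ≡⟨ collapse (+ s ℤ.* x l) (ℤ.- (+ s ℤ.* idM j₀ l)) ⟩
      + s ℤ.* x l ∎

  -- Subtracting `t` copies of a row, whose sum is `g`, leaves sum zero. That row is itself in the
  -- lattice, so st times it can be added back.
  contains : Fin v → ∀ x → (+ g) ∣ℤ sumℤ v x → RowLattice A (λ j → + s ℤ.* x j)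
  contains j₀ x (divides t Σx≡tg) with LinIndep-exists 2≤q (suc r) (ℕ.m≤n⇒m≤1+n r<n)
  ... | b , indep = RowLattice-resp (λ j → identity (+ s) (x j) t (χ b j))
        (RowLattice-+ (sum≡0⇒∈lattice j₀ x′ Σx′≡0) (RowLattice-* (+ s ℤ.* t) (χ∈lattice b indep)))
    where
    open ≡-Reasoning
    x′ : Fin v → ℤ
    x′ j = x j ℤ.+ ℤ.- t ℤ.* χ b j

    identity : ∀ s x t c → s ℤ.* (x ℤ.+ ℤ.- t ℤ.* c) ℤ.+ s ℤ.* t ℤ.* c ≡ s ℤ.* x
    identity = solve-∀
    cancel : ∀ t g → t ℤ.* g ℤ.+ ℤ.- t ℤ.* g ≡ + 0
    cancel = solve-∀

    Σx′≡0 : sumℤ v x′ ≡ + 0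
    Σx′≡0 = begin
      sumℤ v x′                                          ≡⟨ sum-+ v _ _ ⟩
      sumℤ v x ℤ.+ sumℤ v (λ j → ℤ.- t ℤ.* χ b j)
        ≡⟨ cong₂ ℤ._+_ Σx≡tg (trans (sum-*ˡ v (ℤ.- t) (χ b)) (cong (λ e → ℤ.- t ℤ.* e) (count-points r b indep))) ⟩
      t ℤ.* + g ℤ.+ ℤ.- t ℤ.* + g                        ≡⟨ cancel t (+ g) ⟩
      + 0                                                ∎

  contained : ∀ {x} → RowLattice A x → (+ g) ∣ℤ sumℤ v x
  contained {x} (y , e) = subst ((+ g) ∣ℤ_) (sym eq) (∣-sum N (λ i → divides (y i) refl))
    where
    open ≡-Reasoning
    eq : sumℤ v x ≡ sumℤ N (λ i → y i ℤ.* + g)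
    eq = begin
      sumℤ v x                                  ≡⟨ sum-cong v e ⟩
      sumℤ v (y ◁ A)                            ≡⟨ sum-swap v N _ ⟩
      sumℤ N (λ i → sumℤ v (λ j → y i ℤ.* A i j))
        ≡⟨ sum-cong N (λ i → trans (sum-*ˡ v (y i) (A i)) (cong (y i ℤ.*_) (row-sum i))) ⟩
      sumℤ N (λ i → y i ℤ.* + g)                ∎

-- Divisors of prime powers, and the theorem

-- Either `p` divides `d` and is cancelled on both sides, or `d` is coprime to `p` and already
-- divides p^k.
∣p^⇒≡p^ : ∀ {p} → Prime p → ∀ k {d} → d ∣ p ^ k → ∃ λ e → d ≡ p ^ e
∣p^⇒≡p^ pp zero d∣1 = 0 , ℕ∣.∣1⇒≡1 d∣1
∣p^⇒≡p^ {p} pp (suc k) {d} d∣ with p ℕ∣.∣? d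
... | yes (ℕ∣.divides d′ refl) =
  let e , d′≡ = ∣p^⇒≡p^ pp k {d′} (ℕ∣.*-cancelʳ-∣ p (subst (d′ ℕ.* p ∣_) (ℕ.*-comm p (p ^ k)) d∣))
  in suc e , trans (ℕ.*-comm d′ p) (cong (p ℕ.*_) d′≡)
  where instance _ = prime⇒nonZero pp
... | no p∤d = ∣p^⇒≡p^ pp k (coprime-divisor coprime d∣)
  where
  coprime : Coprime d p
  coprime (c∣d , c∣p) with prime⇒irreducible pp c∣p
  ... | inj₁ c≡1  = c≡1
  ... | inj₂ refl = contradiction c∣d p∤d

prime-power-≥2 : ∀ {p m} → Prime p → 1 ℕ.≤ m → 2 ℕ.≤ p ^ m
prime-power-≥2 {p} {suc m} pp _ =
  ℕ.≤-trans (ℕ.nonTrivial⇒n>1 p {{prime⇒nonTrivial pp}}) (ℕ.m≤m*n p (p ^ m))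
  where
  instance
    _ = prime⇒nonZero pp
    _ = ℕ.m^n≢0 p m

theorem3p1 : (p m q : ℕ) → Prime p → 1 ≤ m → q ≡ p ^ m →
    (𝔽 : FiniteField q) → (n r : ℕ) → 1 ≤ n → 1 ≤ r → r ≤ n →
    (N : ℕ) (Y : Fin N → Subset 𝔽 n) → Enumerates 𝔽 n r N Y →
    (v : ℕ) (Z : Fin v → Subset 𝔽 n) → Enumerates 𝔽 n 1 v Z →
    (A : Mat N v) → IsIncidence 𝔽 Y Z A →
    (Σ (Fin v → ℕ) (λ d → IsSmithForm A d))
    × ((d : Fin v → ℕ) → IsSmithForm A d → (i : Fin v) →
        (suc (toℕ i) ≢ v → ∃ λ e → d i ≡ p ^ e)
        × (suc (toℕ i) ≡ v → ∃ λ e → d i ≡ p ^ e * gauss q r))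
theorem3p1 p m q pp 1≤m q≡p^m 𝔽 n (suc r) _ _ r<n N Y EY v Z EZ A incidence =
  smith-form-exists A , λ d smith i →
    -- The column index at hand provides the base point that `contains` asks for.
    let open PinchedLattice A s g (contains i) contained d smith in
    (λ i≢last → p-power (non-last-∣ i i≢last)) ,
    (λ i≡last → let t , d≡tg , t∣s = last≡ i i≡last
                    e , t≡p^e = p-power t∣s
                in e , trans d≡tg (cong₂ ℕ._*_ t≡p^e (sym (gauss≡geometricSum 2≤q (suc r)))))
  where
  2≤q : 2 ℕ.≤ q
  2≤q = subst (2 ℕ.≤_) (sym q≡p^m) (prime-power-≥2 pp 1≤m)

  open Incidence 𝔽 2≤q r<n EY EZ incidence

  instance
    s≢0 : ℕ.NonZero s
    s≢0 = ℕ.m^n≢0 q r {{ℕ.>-nonZero (ℕ.<⇒≤ 2≤q)}}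

  p-power : ∀ {t} → t ∣ s → ∃ λ e → t ≡ p ^ e
  p-power t∣s = ∣p^⇒≡p^ pp (m ℕ.* r)
    (subst (_ ∣_) (trans (cong (_^ r) q≡p^m) (ℕ.^-*-assoc p m r)) t∣s)
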